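{- Let $n\ge 4$ be an integer with $n\equiv 0$ or $1\pmod 4$. For every $\xi\in\mathcal{D}(\mathcal{S}_n)$, the number $s_\xi^{(n)}$ of unlabelled self-complementary graphs $G$ of order $n$ (isomorphism classes of self-complementary graphs of order $n$) with $|\Gamma(G)|=\xi$ satisfies $$s_\xi^{(n)}=\frac{\xi}{n!}\,|\mathcal{L}_\xi(\mathcal{S}_n)|.$$
   Context: Let $V=\{1,\dots,n\}$ and let $\binom{V}{2}$ be the set of 2-element subsets of $V$; write $ij$ for $\{i,j\}$ with $i<j$. A labelled graph of order $n$ is a pair $G=(V,E)$ with $E\subseteq\binom{V}{2}$; $\overline{G}=(V,\binom{V}{2}\setminus E)$ is its complement. Let $A$ be the symmetric group on $V$. For $\alpha\in A$, $\alpha G$ is the graph on $V$ with edge-set $\{\{\alpha i,\alpha j\}: ij\in E\}$, and $\alpha'$ is the permutation of $\binom{V}{2}$ given by $\alpha'\{i,j\}=\{\alpha i,\alpha j\}$. Two labelled graphs $G,H$ are isomorphic if $H=\alpha G$ for some $\alpha\in A$. $\Gamma(G)=\{\alpha\in A:\alpha G=G\}$ is the automorphism group of $G$. $Z(\alpha')$ denotes the set of all cycles (including cycles of length 1) in the disjoint cycle decomposition of $\alpha'$. $G$ is self-complementary if $\alpha G=\overline{G}$ for some $\alpha\in A$; $\mathcal{S}_n$ is the set of all self-complementary labelled graphs on $V$. Put $A_S=\{\alpha\in A:\exists G\in\mathcal{S}_n,\ \alpha G=\overline{G}\}$. Let $\lambda=\binom{n}{2}$, and for $ij\in\binom{V}{2}$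 ($i<j$) let $p_{ij}=\frac{(2n-i)(i-1)}{2}+(j-i)$ and $w(ij)=2^{\lambda-p_{ij}}$; $w$ is a bijection from $\binom{V}{2}$ onto $\{2^0,2^1,\dots,2^{\lambda-1}\}$. For $\alpha\in A_S$, every cycle $z\in Z(\alpha')$ has even length. Write $z=(i_1j_1,i_2j_2,\dots,i_kj_k)$, starting with the element of $z$ at which $w$ is largest, and let $P_1(z)=\{i_1j_1,i_3j_3,\dots,i_{k-1}j_{k-1}\}$ and $P_2(z)=\{i_2j_2,i_4j_4,\dots,i_kj_k\}$. Put $W_1(z)=\sum_{ij\in P_1(z)}w(ij)$, $W_2(z)=\sum_{ij\in P_2(z)}w(ij)$, and define the polynomials $$U_\alpha^{(n)}(x)=\prod_{z\in Z(\alpha')}\bigl(x^{W_1(z)}+x^{W_2(z)}\bigr),\qquad U^{(n)}(x)=\sum_{\alpha\in A_S}U_\alpha^{(n)}(x).$$ Let $d_L$ be the coefficient of $x^L$ in $U^{(n)}(x)$. Put $\mathcal{D}(\mathcal{S}_n)=\{d_L: L\ge 0,\ d_L\ne 0\}$, and for a positive integer $\xi$ put $\mathcal{L}_\xi(\mathcal{S}_n)=\{L: d_L=\xi\}$. -}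

module Defs where

open import Data.Bool.Base using (Bool; true; false; not; _∧_; _∨_)
import Data.Bool.Properties as Bool
open import Data.Empty using (⊥-elim-irr)
open import Data.Fin.Base as Fin using (Fin; toℕ)
import Data.Fin.Properties as Fin
open import Data.Fin.Permutation as Perm
  using (Permutation′; _⟨$⟩ʳ_; _∘ₚ_; insert; inverseˡ; inverseʳ)
open import Data.List.Base
  using (List; []; _∷_; [_]; _++_; map; foldr; filter; replicate; iterate;
         takeWhile; length; allFin; cartesianProduct; cartesianProductWith;
         mapMaybe; drop)
open import Data.List.Membership.Propositional using (_∈_)
open import Data.List.Membership.Propositional.Properties
  using (∈-allFin; ∈-cartesianProduct⁺)
open import Data.List.Relation.Unary.Any as Any using (Any; here; there)
import Data.List.Relation.Unary.Any.Properties as Any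
open import Data.List.Relation.Unary.All as All using (All)
open import Data.Maybe.Base using (Maybe; just; nothing)
import Data.Maybe.Relation.Unary.Any as MAny
open import Data.Nat.Base using (ℕ; zero; suc; _+_; _*_; _∸_; _^_)
open import Data.Nat.Combinatorics using (_C_)
open import Data.Nat.DivMod using (_/_)
import Data.Nat.Properties as ℕ
open import Data.Nat.ListAction using (sum)
open import Data.Product.Base using (∃; _×_; _,_; proj₁; uncurry)
open import Function.Bundles using (Inverse; Injection)
open import Function.Properties.Inverse using (↔⇒↣)
open import Level using (Level; 0ℓ; _⊔_)
open import Relation.Binary.Bundles using (Setoid)
import Relation.Binary.Construct.On as On
open import Relation.Binary.Definitions
  using (DecidableEquality; tri<; tri≈; tri>)
open import Relation.Binary.PropositionalEquality
  using (_≡_; _≢_; _≗_; refl; sym; trans; cong; subst; setoid)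
open import Relation.Nullary.Decidable
  using (Dec; yes; no; does; map′; dec-true; dec-false; ¬?; _×-dec_)
open import Relation.Nullary.Negation using (¬_; contradiction)
open import Relation.Unary using (Pred; Decidable)

private variable
  n : ℕ

module _ {a ℓ p : Level} (S : Setoid a ℓ) where

  Subsetoid : Pred (Setoid.Carrier S) p → Setoid (a ⊔ p) ℓ
  Subsetoid P = On.setoid S (proj₁ {B = P})

module _ {a ℓ : Level} where

  infix 4 _HasCardinality_

  _HasCardinality_ : Setoid a ℓ → ℕ → Set (a ⊔ ℓ)
  S HasCardinality k = Inverse S (setoid (Fin k))

-- A two-element subset of Fin n is listed in increasing order.  The
-- vertex i of {1,…,n} is the element of Fin n whose toℕ is i - 1.
record Edge (n : ℕ) : Set where
  constructor edge
  field
    lo     : Fin n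
    hi     : Fin n
    .lo<hi : lo Fin.< hi

open Edge public

Edge-≡ : {e f : Edge n} → lo e ≡ lo f → hi e ≡ hi f → e ≡ f
Edge-≡ refl refl = refl

infix 4 _≟_

_≟_ : DecidableEquality (Edge n)
e ≟ f = map′ (uncurry Edge-≡) (λ e≡f → cong lo e≡f , cong hi e≡f)
             (lo e Fin.≟ lo f ×-dec hi e Fin.≟ hi f)

pair : (a b : Fin n) → .(a ≢ b) → Edge n
pair a b a≢b with Fin.<-cmp a b
... | tri< a<b _ _ = edge a b a<b
... | tri≈ _ a≡b _ = ⊥-elim-irr (a≢b a≡b)
... | tri> _ _ b<a = edge b a b<a

edges : ∀ n → List (Edge n)
edges n = mapMaybe (uncurry edge?) (cartesianProduct (allFin n) (allFin n))
  module Edges where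
  edge? : Fin n → Fin n → Maybe (Edge n)
  edge? a b with a Fin.<? b
  ... | yes a<b = just (edge a b a<b)
  ... | no  _   = nothing

pair-< : ∀ {a b : Fin n} .(a≢b : a ≢ b) .(a<b : a Fin.< b) →
         pair a b a≢b ≡ edge a b a<b
pair-< {a = a} {b} a≢b a<b with Fin.<-cmp a b
... | tri< _   _ _ = refl
... | tri≈ a≮b _ _ = ⊥-elim-irr (a≮b a<b)
... | tri> a≮b _ _ = ⊥-elim-irr (a≮b a<b)

pair-> : ∀ {a b : Fin n} .(a≢b : a ≢ b) .(b<a : b Fin.< a) →
         pair a b a≢b ≡ edge b a b<a
pair-> {a = a} {b} a≢b b<a with Fin.<-cmp a b
... | tri< _ _ b≮a = ⊥-elim-irr (b≮a b<a)
... | tri≈ _ _ b≮a = ⊥-elim-irr (b≮a b<a)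
... | tri> _ _ _   = refl

pair-comm : ∀ (a b : Fin n) .(a≢b : a ≢ b) .(b≢a : b ≢ a) →
            pair a b a≢b ≡ pair b a b≢a
pair-comm a b a≢b b≢a with Fin.<-cmp a b
... | tri< a<b _ _ = sym (pair-> b≢a a<b)
... | tri≈ _ a≡b _ = ⊥-elim-irr (a≢b a≡b)
... | tri> _ _ b<a = sym (pair-< b≢a b<a)

pair-cong : ∀ {a b c d : Fin n} .{a≢b : a ≢ b} .{c≢d : c ≢ d} →
            a ≡ c → b ≡ d → pair a b a≢b ≡ pair c d c≢d
pair-cong refl refl = refl

∈-edges : (e : Edge n) → e ∈ edges n
∈-edges {n} e@(edge a b a<b) = Any.mapMaybe⁺ (uncurry edge?) _
  (Any.map⁺ (Any.map lemma (∈-cartesianProduct⁺ (∈-allFin a) (∈-allFin b))))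
  where
  open Edges n
  lemma : ∀ {q} → (a , b) ≡ q → MAny.Any (e ≡_) (uncurry edge? q)
  lemma refl with a Fin.<? b
  ... | yes _   = MAny.just refl
  ... | no  a≮b = ⊥-elim-irr (a≮b a<b)

injective : (α : Permutation′ n) {a b : Fin n} → α ⟨$⟩ʳ a ≡ α ⟨$⟩ʳ b → a ≡ b
injective α = Injection.injective (↔⇒↣ α)

infix 8 _′

_′ : Permutation′ n → Edge n → Edge n
(α ′) (edge a b a<b) =
  pair (α ⟨$⟩ʳ a) (α ⟨$⟩ʳ b) (λ αa≡αb → Fin.<⇒≢ a<b (injective α αa≡αb))

′-pair : (α : Permutation′ n) {a b : Fin n} .(a≢b : a ≢ b) →
         (α ′) (pair a b a≢b) ≡
         pair (α ⟨$⟩ʳ a) (α ⟨$⟩ʳ b) (λ eq → a≢b (injective α eq))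
′-pair α {a} {b} a≢b with Fin.<-cmp a b
... | tri< _ _ _   = refl
... | tri≈ _ a≡b _ = ⊥-elim-irr (a≢b a≡b)
... | tri> _ _ _   = pair-comm (α ⟨$⟩ʳ b) (α ⟨$⟩ʳ a) _ _

′-id : (α : Permutation′ n) → α Perm.≈ Perm.id → ∀ e → (α ′) e ≡ e
′-id α α≈id (edge a b a<b) =
  trans (pair-cong (α≈id a) (α≈id b)) (pair-< (λ a≡b → Fin.<⇒≢ a<b a≡b) a<b)

-- In the library β ∘ₚ α applies β first.
′-∘ₚ : (α β : Permutation′ n) → ∀ e → ((β ∘ₚ α) ′) e ≡ (α ′) ((β ′) e)
′-∘ₚ α β (edge a b a<b) =
  sym (′-pair α (λ eq → Fin.<⇒≢ a<b (injective β eq)))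

′-inverseˡ : (α : Permutation′ n) → ∀ e → (Perm.flip α ′) ((α ′) e) ≡ e
′-inverseˡ α e = trans (sym (′-∘ₚ (Perm.flip α) α e))
                       (′-id (α ∘ₚ Perm.flip α) (λ _ → inverseˡ α) e)

′-inverseʳ : (α : Permutation′ n) → ∀ e → (α ′) ((Perm.flip α ′) e) ≡ e
′-inverseʳ α e = trans (sym (′-∘ₚ α (Perm.flip α) e))
                       (′-id (Perm.flip α ∘ₚ α) (λ _ → inverseʳ α) e)

′-injective : (α : Permutation′ n) {e f : Edge n} → (α ′) e ≡ (α ′) f → e ≡ f
′-injective α {e} {f} eq =
  trans (sym (′-inverseˡ α e)) (trans (cong (Perm.flip α ′) eq) (′-inverseˡ α f))

-- Labelled graphs, given by the characteristic function of the edge set;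
-- equality of graphs is _≗_.
Graph : ℕ → Set
Graph n = Edge n → Bool

complement : Graph n → Graph n
complement G e = not (G e)

infixr 7 _·_

-- The edges of α · G are the images under α′ of the edges of G.
_·_ : Permutation′ n → Graph n → Graph n
_·_ {n} α G e =
  does (Any.any? (λ f → (G f Bool.≟ true) ×-dec ((α ′) f ≟ e)) (edges n))

·-apply : (α : Permutation′ n) (G : Graph n) (f : Edge n) →
          (α · G) ((α ′) f) ≡ G f
·-apply {n} α G f with G f in Gf
... | true  = dec-true (Any.any? _ (edges n))
                       (Any.map (λ { refl → Gf , refl }) (∈-edges f))
... | false = dec-false (Any.any? _ (edges n)) absent
  where
  absent : ¬ Any (λ g → G g ≡ true × (α ′) g ≡ (α ′) f) (edges n)
  absent any with Any.satisfied any
  ... | g , Gg , αg≡αf with ′-injective α {g} {f} αg≡αf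
  ... | refl with () ← trans (sym Gg) Gf

·-cong : (α : Permutation′ n) {G H : Graph n} → G ≗ H → α · G ≗ α · H
·-cong α {G} {H} G≗H e =
  subst (λ f → (α · G) f ≡ (α · H) f) (′-inverseʳ α e)
    (trans (·-apply α G f) (trans (G≗H f) (sym (·-apply α H f))))
  where f = (Perm.flip α ′) e

Isomorphic : Graph n → Graph n → Set
Isomorphic {n} G H = ∃ λ (α : Permutation′ n) → H ≗ α · G

Isomorphic-refl : {G : Graph n} → Isomorphic G G
Isomorphic-refl {G = G} = Perm.id , λ e →
  sym (subst (λ f → (Perm.id · G) f ≡ G e) (′-id Perm.id (λ _ → refl) e)
             (·-apply Perm.id G e))

Isomorphic-sym : {G H : Graph n} → Isomorphic G H → Isomorphic H G
Isomorphic-sym {G = G} {H} (α , H≗αG) = Perm.flip α , λ e →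
  sym (subst (λ f → (Perm.flip α · H) f ≡ G e) (′-inverseˡ α e)
    (trans (·-apply (Perm.flip α) H ((α ′) e))
      (trans (H≗αG ((α ′) e)) (·-apply α G e))))

Isomorphic-trans : {G H K : Graph n} →
                   Isomorphic G H → Isomorphic H K → Isomorphic G K
Isomorphic-trans {G = G} {H} {K} (α , H≗αG) (β , K≗βH) = α ∘ₚ β , λ e →
  let g = (Perm.flip α ′) ((Perm.flip β ′) e)
      βαg≡e = trans (cong (β ′) (′-inverseʳ α ((Perm.flip β ′) e))) (′-inverseʳ β e)
  in trans (K≗βH e) (trans (cong (β · H) (sym βαg≡e))
    (trans (·-apply β H ((α ′) g)) (trans (H≗αG ((α ′) g))
      (trans (·-apply α G g) (trans (sym (·-apply (α ∘ₚ β) G g))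
        (cong ((α ∘ₚ β) · G) (trans (′-∘ₚ β α g) βαg≡e)))))))

isomorphismSetoid : ℕ → Setoid 0ℓ 0ℓ
isomorphismSetoid n = record
  { Carrier       = Graph n
  ; _≈_           = Isomorphic
  ; isEquivalence = record
    { refl  = λ {G} → Isomorphic-refl {G = G}
    ; sym   = λ {G} {H} → Isomorphic-sym {G = G} {H}
    ; trans = λ {G} {H} {K} → Isomorphic-trans {G = G} {H} {K}
    }
  }

permutationSetoid : ℕ → Setoid 0ℓ 0ℓ
permutationSetoid n = record
  { Carrier       = Permutation′ n
  ; _≈_           = Perm._≈_
  ; isEquivalence = record
    { refl  = λ _ → refl
    ; sym   = λ α≈β i → sym (α≈β i)
    ; trans = λ α≈β β≈γ i → trans (α≈β i) (β≈γ i)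
    }
  }

Γ : Graph n → Setoid 0ℓ 0ℓ
Γ {n} G = Subsetoid (permutationSetoid n) (λ α → α · G ≗ G)

SelfComplementary : Graph n → Set
SelfComplementary {n} G = ∃ λ (α : Permutation′ n) → α · G ≗ complement G

-- Setoid equality is isomorphism, so the cardinality counts isomorphism classes.
UnlabelledSC : (n ξ : ℕ) → Setoid 0ℓ 0ℓ
UnlabelledSC n ξ = Subsetoid (isomorphismSetoid n)
  (λ G → SelfComplementary G × Γ G HasCardinality ξ)

Aₛ : Pred (Permutation′ n) 0ℓ
Aₛ {n} α = ∃ λ (G : Graph n) → SelfComplementary G × α · G ≗ complement G

subgraphs : List (Edge n) → List (Graph n)
subgraphs []       = [ (λ _ → false) ]
subgraphs (e ∷ es) =
  subgraphs es ++ map (λ G f → does (f ≟ e) ∨ G f) (subgraphs es)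

∈-subgraphs : (es : List (Edge n)) (G : Graph n) →
              (∀ f → G f ≡ true → f ∈ es) → Any (G ≗_) (subgraphs es)
∈-subgraphs [] G G⊆ = here λ f → Bool.¬-not λ Gf → contradiction (G⊆ f Gf) λ ()
∈-subgraphs {n} (e ∷ es) G G⊆ with G e in Ge
... | false = Any.++⁺ˡ (∈-subgraphs es G λ f Gf → tail f Gf (G⊆ f Gf))
  where
  tail : ∀ f → G f ≡ true → f ∈ e ∷ es → f ∈ es
  tail f Gf (here refl)  with () ← trans (sym Gf) Ge
  tail f Gf (there f∈es) = f∈es
... | true = Any.++⁺ʳ (subgraphs es) (Any.map⁺ (Any.map add (∈-subgraphs es G-e G-e⊆)))
  where
  G-e : Graph n
  G-e f = not (does (f ≟ e)) ∧ G f

  G-e⊆ : ∀ f → G-e f ≡ true → f ∈ es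
  G-e⊆ f = lemma (f ≟ e)
    where
    lemma : (q : Dec (f ≡ e)) → not (does q) ∧ G f ≡ true → f ∈ es
    lemma (no f≢e) Gf with G⊆ f Gf
    ... | here f≡e   = contradiction f≡e f≢e
    ... | there f∈es = f∈es

  add : ∀ {H} → G-e ≗ H → ∀ f → G f ≡ does (f ≟ e) ∨ H f
  add G-e≗H f = trans (lemma (f ≟ e)) (cong (does (f ≟ e) ∨_) (G-e≗H f))
    where
    lemma : (q : Dec (f ≡ e)) → G f ≡ does q ∨ not (does q) ∧ G f
    lemma (yes refl) = Ge
    lemma (no _)     = refl

Aₛ? : Decidable (Aₛ {n})
Aₛ? {n} α = map′ to from
  (Any.any? (λ G → All.all? (λ e → (α · G) e Bool.≟ complement G e) (edges n))
            (subgraphs (edges n)))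
  where
  to : Any (λ G → All (λ e → (α · G) e ≡ complement G e) (edges n))
           (subgraphs (edges n)) → Aₛ α
  to any with Any.satisfied any
  ... | G , all = G , (α , αG≗Ḡ) , αG≗Ḡ
    where
    αG≗Ḡ : α · G ≗ complement G
    αG≗Ḡ e = All.lookup all (∈-edges e)

  from : Aₛ α → Any (λ G → All (λ e → (α · G) e ≡ complement G e) (edges n))
                     (subgraphs (edges n))
  from (G , _ , αG≗Ḡ) = Any.map
    (λ G≗H → All.universal (λ e → trans (sym (·-cong α G≗H e))
                                        (trans (αG≗Ḡ e) (cong not (G≗H e)))) _)
    (∈-subgraphs (edges n) G (λ f _ → ∈-edges f))

-- Up to ≈, each permutation of Fin (suc n) is insert zero j π for exactly one
-- value j of zero and one π.
permutations : ∀ n → List (Permutation′ n)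
permutations zero    = [ Perm.id ]
permutations (suc n) =
  cartesianProductWith (insert Fin.zero) (allFin (suc n)) (permutations n)

-- The product halved here is always even.
p : Edge n → ℕ
p {n} e = (2 * n ∸ i) * (i ∸ 1) / 2 + (j ∸ i)
  where
  i = suc (toℕ (lo e))
  j = suc (toℕ (hi e))

w : Edge n → ℕ
w {n} e = 2 ^ (n C 2 ∸ p e)

-- The cycle of α′ through e, listed as e, α′e, α′²e, …
cycleFrom : Permutation′ n → Edge n → List (Edge n)
cycleFrom {n} α e =
  e ∷ takeWhile (λ f → ¬? (f ≟ e)) (iterate (α ′) ((α ′) e) (length (edges n)))

-- As w is injective, each cycle of α′ has exactly one edge of maximal weight;
-- the cycle is listed once, starting from that edge.
Z : Permutation′ n → List (List (Edge n))
Z {n} α = map (cycleFrom α)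
  (filter (λ e → All.all? (λ f → w f ℕ.≤? w e) (cycleFrom α e)) (edges n))

everyOther : ∀ {a} {A : Set a} → List A → List A
everyOther []           = []
everyOther (x ∷ [])     = x ∷ []
everyOther (x ∷ _ ∷ xs) = x ∷ everyOther xs

P₁ P₂ : List (Edge n) → List (Edge n)
P₁ z = everyOther z
P₂ z = everyOther (drop 1 z)

W₁ W₂ : List (Edge n) → ℕ
W₁ z = sum (map w (P₁ z))
W₂ z = sum (map w (P₂ z))

-- Coefficient lists over ℕ, constant term first, possibly with trailing zeros.
Poly : Set
Poly = List ℕ

coeff : Poly → ℕ → ℕ
coeff []      _       = 0
coeff (a ∷ _) zero    = a
coeff (_ ∷ f) (suc k) = coeff f k

infixl 6 _⊕_
infixl 7 _⊗_

_⊕_ : Poly → Poly → Poly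
[]      ⊕ g       = g
(a ∷ f) ⊕ []      = a ∷ f
(a ∷ f) ⊕ (b ∷ g) = a + b ∷ f ⊕ g

_⊗_ : Poly → Poly → Poly
[]      ⊗ g = []
(a ∷ f) ⊗ g = map (a *_) g ⊕ (0 ∷ f ⊗ g)

x^_ : ℕ → Poly
x^ k = replicate k 0 ++ [ 1 ]

Σₚ Πₚ : List Poly → Poly
Σₚ = foldr _⊕_ []
Πₚ = foldr _⊗_ [ 1 ]

Uα : Permutation′ n → Poly
Uα α = Πₚ (map (λ z → (x^ W₁ z) ⊕ (x^ W₂ z)) (Z α))

U : ℕ → Poly
U n = Σₚ (map Uα (filter Aₛ? (permutations n)))

d : (n L : ℕ) → ℕ
d n L = coeff (U n) L

𝒟 : ℕ → Pred ℕ 0ℓ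
𝒟 n ξ = ∃ λ L → d n L ≢ 0 × ξ ≡ d n L

𝓛 : (ξ n : ℕ) → Setoid 0ℓ 0ℓ
𝓛 ξ n = Subsetoid (setoid ℕ) (λ L → d n L ≡ ξ)

{-# OPTIONS --safe #-}

-- As w takes distinct powers of two as values, a labelled graph G is determined
-- by its weight, the sum of w over its edges.  Expanding the product defining
-- Uα α amounts to choosing P₁ z or P₂ z for every cycle z of α′, and these
-- choices are exactly the graphs G with α · G ≗ complement G.  Hence the
-- coefficient of U n at the weight of G counts the permutations carrying G to
-- its complement, a coset of Γ G when G is self-complementary, and all other
-- coefficients vanish.  So 𝓛 ξ n counts the labelled self-complementary graphs
-- with ξ automorphisms, and by orbit–stabiliser every isomorphism class
-- contains n ! / ξ of them.

module Submission where

open import Defs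

-- Cardinalities are handled as finite sums of indicator values over lists, so that a bijection
-- becomes a change of variables (`∑-reindex`) and double counting becomes `∑-swap`. Permutations
-- and graphs are compared by equalities coarser than `_≡_`, and enumerating them means having
-- multiplicity 1 up to `_≈_`. The delicate point is the claim that every choice of halves gives a
-- graph carried to its complement. The list of a cycle records the steps from one entry to the next
-- but not the closing step from the last entry to the first, and there the even length of the cycle
-- matters. Membership in `Aₛ` settles this: it supplies a reference graph that alternates under
-- `α ′` everywhere. On each cycle `z` the halves `P₁ z` and `P₂ z` are the two level sets of this
-- reference graph, so any choice agrees on `z` with it or with its complement, and inherits the
-- alternation, closing step included.

module Development where


  open import Data.Bool.Base using (Bool; if_then_else_; true; false; not)
  import Data.Bool.Properties as Bool
  open import Data.Empty using (⊥-elim-irr)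
  open import Data.Fin.Base as Fin using (Fin; zero; suc; punchIn; toℕ)
  open import Data.Fin.Permutation as Perm
    using (Permutation′; _⟨$⟩ʳ_; _∘ₚ_; flip; insert; remove; insert-punchIn; punchIn-permute)
  import Data.Fin.Properties as Fin
  import Data.Integer.Base as ℤ
  import Data.Integer.Properties as ℤ
  open import Data.List.Base
    using (List; []; _∷_; [_]; _++_; map; filter; concat; drop; length; lookup; allFin;
           tabulate; cartesianProduct; cartesianProductWith; mapMaybe; takeWhile; iterate)
  import Data.Nat.Properties as ℕ
  open import Data.List.Extrema ℕ.≤-totalOrder using (argmax; argmax-all; f[xs]≤f[argmax])
  open import Data.List.Membership.Propositional using () renaming (_∈_ to _∈ˡ_)
  open import Data.List.Membership.Propositional.Properties
    using (∈-lookup; ∈-++⁺ˡ; ∈-++⁺ʳ; ∈-++⁻; ∈-map⁺; ∈-map⁻; ∈-concat⁺′; ∈-concat⁻′)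
  open import Data.List.Properties
    using (map-cong; map-++; map-∘; map-tabulate; length-map; length-tabulate;
           filter-++; filter-accept; filter-reject)
  open import Data.List.Relation.Unary.All as All using (All; []; _∷_)
  import Data.List.Relation.Unary.All.Properties as All
  open import Data.List.Relation.Unary.Any as Any using (Any; here; there)
  import Data.List.Relation.Unary.Any.Properties as Any
  open import Data.List.Relation.Unary.Linked as Linked using (Linked; []; [-]; _∷_)
  open import Data.Maybe.Base using (Maybe; just; nothing; maybe)
  open import Data.Nat.Base
    using (ℕ; zero; suc; _+_; _*_; _∸_; _^_; _≤_; _<_; z≤n; s≤s; z<s; _!; NonZero)
  open import Data.Nat.Combinatorics using (_C_; nC1≡n; nCk+nC[k+1]≡[n+1]C[k+1])
  open import Data.Nat.DivMod using (_/_; +-distrib-/-∣ʳ; m*n/n≡m)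
  open import Data.Nat.Divisibility using (n∣m*n)
  open import Data.Nat.GeneralisedArithmetic using () renaming (iterate to power)
  open import Data.Nat.ListAction using (sum)
  open import Data.Nat.ListAction.Properties using (sum-++)
  open import Data.Nat.Tactic.RingSolver using (solve-∀)
  open import Data.Product.Base using (∃; ∃₂; _×_; _,_; proj₁; proj₂; uncurry)
  import Data.Rational.Base as ℚ
  import Data.Rational.Properties as ℚ
  import Data.Rational.Unnormalised.Base as ℚᵘ
  import Data.Rational.Unnormalised.Properties as ℚᵘ
  open import Data.Sum.Base using (_⊎_; inj₁; inj₂; [_,_]′)
  open import Function.Base using (_∘_; id)
  import Function.Construct.Composition as Composition
  import Function.Construct.Symmetry as Symmetry
  open import Level using (Level; 0ℓ)
  open import Relation.Binary.Bundles using (DecSetoid; Setoid)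
  open import Relation.Binary.Definitions using (DecidableEquality; tri<; tri≈; tri>)
  open import Relation.Binary.PropositionalEquality
    using (_≡_; _≢_; _≗_; refl; sym; trans; cong; cong₂; subst; module ≡-Reasoning)
  open import Relation.Binary.PropositionalEquality.Properties using (decSetoid)
  open import Relation.Nullary.Decidable
    using (Dec; yes; no; does; recompute; dec-true; dec-false; map′; ¬?; _×-dec_)
  open import Relation.Nullary.Negation using (¬_; contradiction)
  open import Relation.Unary using (Pred; Decidable)

  private variable
    a b ℓ q r : Level
    A : Set a
    B : Set b
    D : Set q
    P : Set q
    Q : Set r
    R : Set ℓ
    n : ℕ

  -- Finite sums and multiplicities

  -- The Iverson bracket.
  ⟦_⟧ : Dec P → ℕ
  ⟦ P? ⟧ = if does P? then 1 else 0

  ⟦⟧-true : (P? : Dec P) → P → ⟦ P? ⟧ ≡ 1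
  ⟦⟧-true P? p = cong (if_then 1 else 0) (dec-true P? p)

  ⟦⟧-false : (P? : Dec P) → ¬ P → ⟦ P? ⟧ ≡ 0
  ⟦⟧-false P? ¬p = cong (if_then 1 else 0) (dec-false P? ¬p)

  ⟦⟧-⇔ : (P? : Dec P) (Q? : Dec Q) → (P → Q) → (Q → P) → ⟦ P? ⟧ ≡ ⟦ Q? ⟧
  ⟦⟧-⇔ (yes p) Q? to from = sym (⟦⟧-true Q? (to p))
  ⟦⟧-⇔ (no ¬p) Q? to from = sym (⟦⟧-false Q? (¬p ∘ from))

  ⟦⟧≢0 : (P? : Dec P) → ⟦ P? ⟧ ≢ 0 → P
  ⟦⟧≢0 (yes p) _   = p
  ⟦⟧≢0 (no _)  0≢0 = contradiction refl 0≢0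

  ⟦⟧≤1 : (P? : Dec P) → ⟦ P? ⟧ ≤ 1
  ⟦⟧≤1 (yes _) = s≤s z≤n
  ⟦⟧≤1 (no _)  = z≤n

  -- `R` is kept apart from `P × Q` so that the bracket of an independently given decision, such as
  -- equality of edges, can be factored.
  ⟦×⟧ : (P? : Dec P) (Q? : Dec Q) (R? : Dec R) →
        (R → P × Q) → (P → Q → R) → ⟦ R? ⟧ ≡ ⟦ P? ⟧ * ⟦ Q? ⟧
  ⟦×⟧ (yes p) (yes q) R? to from = ⟦⟧-true R? (from p q)
  ⟦×⟧ (yes p) (no ¬q) R? to from = ⟦⟧-false R? (¬q ∘ proj₂ ∘ to)
  ⟦×⟧ (no ¬p) Q?      R? to from = ⟦⟧-false R? (¬p ∘ proj₁ ∘ to)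

  ∑ : List A → (A → ℕ) → ℕ
  ∑ xs f = sum (map f xs)

  ∑-cong-∈ : (xs : List A) {f g : A → ℕ} → (∀ {x} → x ∈ˡ xs → f x ≡ g x) →
             ∑ xs f ≡ ∑ xs g
  ∑-cong-∈ []       f≡g = refl
  ∑-cong-∈ (x ∷ xs) f≡g = cong₂ _+_ (f≡g (here refl)) (∑-cong-∈ xs (f≡g ∘ there))

  ∑-cong : (xs : List A) {f g : A → ℕ} → f ≗ g → ∑ xs f ≡ ∑ xs g
  ∑-cong xs f≗g = cong sum (map-cong f≗g xs)

  ∑-++ : (xs ys : List A) (f : A → ℕ) → ∑ (xs ++ ys) f ≡ ∑ xs f + ∑ ys f
  ∑-++ xs ys f = trans (cong sum (map-++ f xs ys)) (sum-++ (map f xs) (map f ys))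

  ∑-map : (g : B → A) (xs : List B) (f : A → ℕ) → ∑ (map g xs) f ≡ ∑ xs (f ∘ g)
  ∑-map g xs f = cong sum (sym (map-∘ xs))

  ∑-+ : (xs : List A) (f g : A → ℕ) → ∑ xs (λ x → f x + g x) ≡ ∑ xs f + ∑ xs g
  ∑-+ []       f g = refl
  ∑-+ (x ∷ xs) f g =
    trans (cong (f x + g x +_) (∑-+ xs f g)) (interchange (f x) _ _ _)
    where
    interchange : ∀ k l m n → k + l + (m + n) ≡ k + m + (l + n)
    interchange = solve-∀

  ∑-const : (xs : List A) (k : ℕ) → ∑ xs (λ _ → k) ≡ length xs * k
  ∑-const []       k = refl
  ∑-const (x ∷ xs) k = cong (k +_) (∑-const xs k)

  ∑-*ˡ : (xs : List A) (k : ℕ) (f : A → ℕ) → ∑ xs (λ x → k * f x) ≡ k * ∑ xs f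
  ∑-*ˡ []       k f = sym (ℕ.*-zeroʳ k)
  ∑-*ˡ (x ∷ xs) k f =
    trans (cong (k * f x +_) (∑-*ˡ xs k f)) (sym (ℕ.*-distribˡ-+ k (f x) _))

  ∑-*ʳ : (xs : List A) (f : A → ℕ) (k : ℕ) → ∑ xs (λ x → f x * k) ≡ ∑ xs f * k
  ∑-*ʳ xs f k =
    trans (∑-cong xs λ x → ℕ.*-comm (f x) k)
          (trans (∑-*ˡ xs k f) (ℕ.*-comm k (∑ xs f)))

  ∑-swap : (xs : List A) (ys : List B) (f : A → B → ℕ) →
           ∑ xs (λ x → ∑ ys (f x)) ≡ ∑ ys (λ y → ∑ xs (λ x → f x y))
  ∑-swap []       ys f = sym (trans (∑-const ys 0) (ℕ.*-zeroʳ (length ys)))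
  ∑-swap (x ∷ xs) ys f =
    trans (cong (∑ ys (f x) +_) (∑-swap xs ys f)) (sym (∑-+ ys (f x) _))

  ∑-filter : {P : Pred A q} (P? : Decidable P) (xs : List A) (f : A → ℕ) →
             ∑ (filter P? xs) f ≡ ∑ xs (λ x → ⟦ P? x ⟧ * f x)
  ∑-filter P? []       f = refl
  ∑-filter P? (x ∷ xs) f with does (P? x)
  ... | true  = cong₂ _+_ (sym (ℕ.*-identityˡ (f x))) (∑-filter P? xs f)
  ... | false = ∑-filter P? xs f

  ∑-cartesianProductWith :
    (g : A → B → D) (xs : List A) (ys : List B) (f : D → ℕ) →
    ∑ (cartesianProductWith g xs ys) f ≡ ∑ xs (λ x → ∑ ys (λ y → f (g x y)))
  ∑-cartesianProductWith g []       ys f = refl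
  ∑-cartesianProductWith g (x ∷ xs) ys f =
    trans (∑-++ (map (g x) ys) _ f)
          (cong₂ _+_ (∑-map (g x) ys f) (∑-cartesianProductWith g xs ys f))

  length-∑ : (xs : List A) → length xs ≡ ∑ xs (λ _ → 1)
  length-∑ xs = sym (trans (∑-const xs 1) (ℕ.*-identityʳ (length xs)))

  length-filter-∑ : {P : Pred A q} (P? : Decidable P) (xs : List A) →
                    length (filter P? xs) ≡ ∑ xs (λ x → ⟦ P? x ⟧)
  length-filter-∑ P? xs = begin
    length (filter P? xs)             ≡⟨ length-∑ (filter P? xs) ⟩
    ∑ (filter P? xs) (λ _ → 1)        ≡⟨ ∑-filter P? xs _ ⟩
    ∑ xs (λ x → ⟦ P? x ⟧ * 1)         ≡⟨ ∑-cong xs (λ x → ℕ.*-identityʳ ⟦ P? x ⟧) ⟩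
    ∑ xs (λ x → ⟦ P? x ⟧)             ∎
    where open ≡-Reasoning

  ∑-mapMaybe : (g : A → Maybe B) (xs : List A) (f : B → ℕ) →
               ∑ (mapMaybe g xs) f ≡ ∑ xs (λ x → maybe f 0 (g x))
  ∑-mapMaybe g []       f = refl
  ∑-mapMaybe g (x ∷ xs) f with g x
  ... | just y  = cong (f y +_) (∑-mapMaybe g xs f)
  ... | nothing = ∑-mapMaybe g xs f

  ∑-concat : (xss : List (List A)) (f : A → ℕ) → ∑ (concat xss) f ≡ ∑ xss (λ xs → ∑ xs f)
  ∑-concat []         f = refl
  ∑-concat (xs ∷ xss) f = trans (∑-++ xs (concat xss) f) (cong (∑ xs f +_) (∑-concat xss f))

  ∑≢0 : (xs : List A) (f : A → ℕ) → ∑ xs f ≢ 0 → ∃ λ x → x ∈ˡ xs × f x ≢ 0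
  ∑≢0 []       f 0≢0 = contradiction refl 0≢0
  ∑≢0 (x ∷ xs) f ≢0  with f x in eq
  ... | suc k = x , here refl , λ fx≡0 → ℕ.1+n≢0 (trans (sym eq) fx≡0)
  ... | zero  with y , y∈xs , fy≢0 ← ∑≢0 xs f ≢0 = y , there y∈xs , fy≢0

  -- A list enumerates a setoid up to _≈_ when every element has multiplicity 1 in it.
  module Multiplicity (S : DecSetoid a ℓ) where

    open DecSetoid S using (Carrier; _≈_; setoid)
      renaming (_≟_ to _≈?_; refl to ≈-refl; sym to ≈-sym; trans to ≈-trans)

    mult : Carrier → List Carrier → ℕ
    mult y xs = ∑ xs λ x → ⟦ y ≈? x ⟧

    Any⇒mult≢0 : ∀ {y xs} → Any (y ≈_) xs → mult y xs ≢ 0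
    Any⇒mult≢0 {y} (here {x} y≈x) eq =
      ℕ.1+n≢0 (trans (sym (⟦⟧-true (y ≈? x) y≈x)) (ℕ.m+n≡0⇒m≡0 ⟦ y ≈? x ⟧ eq))
    Any⇒mult≢0 {y} (there {x} y∈xs) eq =
      Any⇒mult≢0 y∈xs (ℕ.m+n≡0⇒n≡0 ⟦ y ≈? x ⟧ eq)

    mult≢0⇒Any : ∀ {y} xs → mult y xs ≢ 0 → Any (y ≈_) xs
    mult≢0⇒Any []       0≢0 = contradiction refl 0≢0
    mult≢0⇒Any {y} (x ∷ xs) ≢0 with y ≈? x
    ... | yes y≈x = here y≈x
    ... | no  _   = there (mult≢0⇒Any xs ≢0)

    ∑-pick : ∀ y xs {f : Carrier → ℕ} → (∀ {x} → y ≈ x → f x ≡ f y) →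
             ∑ xs (λ x → ⟦ y ≈? x ⟧ * f x) ≡ mult y xs * f y
    ∑-pick y xs {f} f-cong = trans (∑-cong xs pick) (∑-*ʳ xs _ (f y))
      where
      pick : ∀ x → ⟦ y ≈? x ⟧ * f x ≡ ⟦ y ≈? x ⟧ * f y
      pick x with y ≈? x
      ... | yes y≈x = cong (1 *_) (f-cong y≈x)
      ... | no  _   = refl

    mult-filter : ∀ {P : Pred Carrier q} (P? : Decidable P) {y} xs →
                  (∀ {x} → y ≈ x → P x) → mult y (filter P? xs) ≡ mult y xs
    mult-filter P? {y} xs Px = trans (∑-filter P? xs _) (∑-cong xs lemma)
      where
      lemma : ∀ x → ⟦ P? x ⟧ * ⟦ y ≈? x ⟧ ≡ ⟦ y ≈? x ⟧
      lemma x with y ≈? x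
      ... | yes y≈x = cong (_* 1) (⟦⟧-true (P? x) (Px y≈x))
      ... | no  _   = ℕ.*-zeroʳ ⟦ P? x ⟧

    nub : List Carrier → List Carrier
    nub []       = []
    nub (x ∷ xs) = if does (Any.any? (x ≈?_) xs) then nub xs else x ∷ nub xs

    mult-nub : ∀ {y} xs → Any (y ≈_) xs → mult y (nub xs) ≡ 1
    mult-nub-0 : ∀ {y} xs → ¬ Any (y ≈_) xs → mult y (nub xs) ≡ 0

    mult-nub {y} (x ∷ xs) y∈ with Any.any? (x ≈?_) xs | y∈
    ... | yes x∈xs | here y≈x   = mult-nub xs (Any.map (≈-trans y≈x) x∈xs)
    ... | yes _    | there y∈xs = mult-nub xs y∈xs
    ... | no  x∉xs | here y≈x   = cong₂ _+_ (⟦⟧-true (y ≈? x) y≈x)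
      (mult-nub-0 xs (x∉xs ∘ Any.map (≈-trans (≈-sym y≈x))))
    ... | no  x∉xs | there y∈xs = cong₂ _+_
      (⟦⟧-false (y ≈? x) λ y≈x → x∉xs (Any.map (≈-trans (≈-sym y≈x)) y∈xs))
      (mult-nub xs y∈xs)

    mult-nub-0 []       _ = refl
    mult-nub-0 {y} (x ∷ xs) y∉ with Any.any? (x ≈?_) xs
    ... | yes _ = mult-nub-0 xs (y∉ ∘ there)
    ... | no  _ = cong₂ _+_ (⟦⟧-false (y ≈? x) (y∉ ∘ here)) (mult-nub-0 xs (y∉ ∘ there))

    nub-All : ∀ {P : Pred Carrier q} {xs} → All P xs → All P (nub xs)
    nub-All [] = []
    nub-All {xs = x ∷ xs} (px ∷ pxs) with does (Any.any? (x ≈?_) xs)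
    ... | true  = nub-All pxs
    ... | false = px ∷ nub-All pxs

    -- Two different positions would contribute 2 to the multiplicity.
    index-unique : ∀ {y} xs → mult y xs ≤ 1 → (i j : Fin (length xs)) →
                   y ≈ lookup xs i → y ≈ lookup xs j → i ≡ j
    index-unique (x ∷ xs) _ zero    zero    _ _ = refl
    index-unique {y} (x ∷ xs) ≤1 zero (suc j) y≈x y≈xⱼ =
      contradiction (ℕ.n≤0⇒n≡0 (ℕ.+-cancelˡ-≤ 1 _ _
        (subst (λ k → k + mult y xs ≤ 1) (⟦⟧-true (y ≈? x) y≈x) ≤1)))
        (Any⇒mult≢0 (lose xs j y≈xⱼ))
      where
      lose : ∀ xs (j : Fin (length xs)) → y ≈ lookup xs j → Any (y ≈_) xs
      lose (_ ∷ _)  zero    = here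
      lose (_ ∷ xs) (suc j) = there ∘ lose xs j
    index-unique (x ∷ xs) ≤1 (suc i) zero y≈xᵢ y≈x =
      sym (index-unique (x ∷ xs) ≤1 zero (suc i) y≈x y≈xᵢ)
    index-unique {y} (x ∷ xs) ≤1 (suc i) (suc j) y≈xᵢ y≈xⱼ =
      cong suc (index-unique xs (ℕ.m+n≤o⇒n≤o ⟦ y ≈? x ⟧ ≤1) i j y≈xᵢ y≈xⱼ)

    -- Multiplicity 1 is used in two halves: being nonzero it provides a position for `y`, and being
    -- at most 1 it makes that position unique, hence independent of the representative.
    cardinality : {P : Pred Carrier q} (xs : List Carrier) → All P xs →
                  (∀ y → P y → mult y xs ≡ 1) →
                  Subsetoid setoid P HasCardinality length xs
    cardinality {P = P} xs Pxs once = record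
      { to        = λ (y , Py) → Any.index (find y Py)
      ; from      = λ i → lookup xs i , All.lookup Pxs (∈-lookup i)
      ; to-cong   = λ {(y , Py)} {(z , Pz)} y≈z →
          unique y Py _ _ (found y Py) (≈-trans y≈z (found z Pz))
      ; from-cong = λ { refl → ≈-refl }
      ; inverse   = (λ {i} {(y , Py)} y≈xᵢ → unique y Py _ i (found y Py) y≈xᵢ)
                  , (λ { {(y , Py)} refl → ≈-sym (found y Py) })
      }
      where
      find : ∀ y → P y → Any (y ≈_) xs
      find y Py = mult≢0⇒Any xs λ eq → ℕ.1+n≢0 (trans (sym (once y Py)) eq)
      found : ∀ y Py → y ≈ lookup xs (Any.index (find y Py))
      found y Py = Any.lookup-index (find y Py)
      unique : ∀ y → P y → ∀ i j → y ≈ lookup xs i → y ≈ lookup xs j → i ≡ j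
      unique y Py = index-unique xs (ℕ.≤-reflexive (once y Py))

  cardinality-unique : {S : Setoid a ℓ} {k l : ℕ} →
                       S HasCardinality k → S HasCardinality l → k ≡ l
  cardinality-unique S≅k S≅l =
    Perm.↔⇒≡ (Composition.inverse (Symmetry.inverse S≅k) S≅l)

  -- Orbits of an injective self-map of a finite set

  module Orbits {a} {A : Set a} (_≟_ : DecidableEquality A)
                (xs : List A) (∈-xs : ∀ x → x ∈ˡ xs)
                (f : A → A) (f-injective : ∀ {x y} → f x ≡ f y → x ≡ y) where

    open Multiplicity (decSetoid _≟_)

    power-+ : ∀ i j x → power f x (i + j) ≡ power f (power f x i) j
    power-+ zero    j x = refl
    power-+ (suc i) j x = power-+ i j (f x)

    power-suc : ∀ i x → power f x (suc i) ≡ f (power f x i)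
    power-suc zero    x = refl
    power-suc (suc i) x = power-suc i (f x)

    power-injective : ∀ i {x y} → power f x i ≡ power f y i → x ≡ y
    power-injective zero    eq = eq
    power-injective (suc i) eq = f-injective (power-injective i eq)

    -- Among the `length xs + 1` powers of `f` from exponent 0 on, two agree at `x` by the
    -- pigeonhole principle, and injectivity cancels the smaller exponent. The bound places the
    -- return inside the list that `orbit` truncates.
    returns : ∀ x → ∃ λ k → k < length xs × power f (f x) k ≡ x
    returns x with i , j , i<j , eq ← Fin.pigeonhole (ℕ.n<1+n (length xs))
                                        (λ i → Any.index (∈-xs (power f x (toℕ i)))) =
      period (toℕ j ∸ toℕ i) (ℕ.m<n⇒0<n∸m i<j)
        (ℕ.≤-trans (ℕ.m∸n≤m (toℕ j) (toℕ i)) (ℕ.≤-pred (Fin.toℕ<n j)))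
        (power-injective (toℕ i) (begin
          power f (power f x (toℕ j ∸ toℕ i)) (toℕ i)
            ≡⟨ power-+ (toℕ j ∸ toℕ i) (toℕ i) x ⟨
          power f x (toℕ j ∸ toℕ i + toℕ i)
            ≡⟨ cong (power f x) (ℕ.m∸n+n≡m (ℕ.<⇒≤ i<j)) ⟩
          power f x (toℕ j)
            ≡⟨ Any.lookup-index (∈-xs (power f x (toℕ j))) ⟩
          lookup xs (Any.index (∈-xs (power f x (toℕ j))))
            ≡⟨ cong (lookup xs) eq ⟨
          lookup xs (Any.index (∈-xs (power f x (toℕ i))))
            ≡⟨ Any.lookup-index (∈-xs (power f x (toℕ i))) ⟨
          power f x (toℕ i) ∎))
      where
      open ≡-Reasoning
      period : ∀ k → 0 < k → k ≤ length xs → power f x k ≡ x →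
               ∃ λ k → k < length xs × power f (f x) k ≡ x
      period (suc k) _ k<l eq = k , k<l , eq

    -- Here `j` is the first hitting time of `x`; the hit at `k < m` guarantees that `takeWhile`
    -- stops at `x` and not because the list has run out.
    takeWhile-power : ∀ x y m {k} → k < m → power f y k ≡ x →
      ∃ λ j → takeWhile (λ z → ¬? (z ≟ x)) (iterate f y m) ≡ iterate f y j ×
              power f y j ≡ x × (∀ {i} → i < j → power f y i ≢ x)
    takeWhile-power x y (suc m) {k} k<m eq with y ≟ x
    ... | yes y≡x = 0 , refl , y≡x , λ ()
    takeWhile-power x y (suc m) {zero}  _         eq | no y≢x = contradiction eq y≢x
    takeWhile-power x y (suc m) {suc k} (s≤s k<m) eq | no y≢x
      with j , taken , end , before ← takeWhile-power x (f y) m k<m eq =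
        suc j , cong (y ∷_) taken , end , λ
          { {zero} _ → y≢x ; {suc i} (s≤s i<j) → before i<j }

    orbit : A → List A
    orbit x = x ∷ takeWhile (λ z → ¬? (z ≟ x)) (iterate f (f x) (length xs))

    abstract
      -- `suc k` is the least positive period. It is opaque: what follows uses only these properties
      -- and never the pigeonhole search behind it.
      orbit-period : ∀ x → ∃ λ k → orbit x ≡ iterate f x (suc k) × power f x (suc k) ≡ x ×
                                   (∀ {i} → i < k → power f x (suc i) ≢ x)
      orbit-period x with k , k<l , eq ← returns x
        with j , taken , end , before ← takeWhile-power x (f x) (length xs) k<l eq =
          j , cong (x ∷_) taken , end , before

    ∈-iterate⁺ : ∀ x {i k} → i < k → power f x i ∈ˡ iterate f x k
    ∈-iterate⁺ x {zero}  {suc k} _         = here refl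
    ∈-iterate⁺ x {suc i} {suc k} (s≤s i<k) = there (∈-iterate⁺ (f x) i<k)

    ∈-iterate⁻ : ∀ x k {y} → y ∈ˡ iterate f x k → ∃ λ i → i < k × y ≡ power f x i
    ∈-iterate⁻ x (suc k) (here refl) = 0 , z<s , refl
    ∈-iterate⁻ x (suc k) (there y∈) with i , i<k , eq ← ∈-iterate⁻ (f x) k y∈ = suc i , s≤s i<k , eq

    ∈-orbit⁻ : ∀ x {y} → y ∈ˡ orbit x → ∃ λ i → y ≡ power f x i
    ∈-orbit⁻ x {y} y∈ with k , orbit≡ , _ ← orbit-period x
      with i , _ , eq ← ∈-iterate⁻ x (suc k) (subst (y ∈ˡ_) orbit≡ y∈) = i , eq

    orbit-closed : ∀ x {y} → y ∈ˡ orbit x → f y ∈ˡ orbit x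
    orbit-closed x {y} y∈ with k , orbit≡ , end , _ ← orbit-period x
      with i , i≤k , refl ← ∈-iterate⁻ x (suc k) (subst (y ∈ˡ_) orbit≡ y∈)
      -- Only the last entry wraps round to `x`.
      with suc i ℕ.≟ suc k
    ... | yes refl = here (trans (sym (power-suc i x)) end)
    ... | no  i≢k  = subst (f (power f x i) ∈ˡ_) (sym orbit≡)
      (subst (_∈ˡ iterate f x (suc k)) (power-suc i x)
        (∈-iterate⁺ x (ℕ.≤∧≢⇒< i≤k i≢k)))

    ∈-orbit⁺ : ∀ x i {y} → y ∈ˡ orbit x → power f y i ∈ˡ orbit x
    ∈-orbit⁺ x zero    y∈ = y∈
    ∈-orbit⁺ x (suc i) y∈ = ∈-orbit⁺ x i (orbit-closed x y∈)

    ∈-orbit-trans : ∀ {x y z} → y ∈ˡ orbit x → z ∈ˡ orbit y → z ∈ˡ orbit x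
    ∈-orbit-trans {x} {y} y∈ z∈ with i , refl ← ∈-orbit⁻ y z∈ = ∈-orbit⁺ x i y∈

    -- From the `i`-th power, the remaining `suc k ∸ i` steps complete the period.
    ∈-orbit-sym : ∀ {x y} → y ∈ˡ orbit x → x ∈ˡ orbit y
    ∈-orbit-sym {x} {y} y∈ with k , orbit≡ , end , _ ← orbit-period x
      with i , i≤k , refl ← ∈-iterate⁻ x (suc k) (subst (y ∈ˡ_) orbit≡ y∈) =
        subst (_∈ˡ orbit (power f x i)) (begin
          power f (power f x i) (suc k ∸ i)  ≡⟨ power-+ i (suc k ∸ i) x ⟨
          power f x (i + (suc k ∸ i))        ≡⟨ cong (power f x) (ℕ.m+[n∸m]≡n (ℕ.<⇒≤ i≤k)) ⟩
          power f x (suc k)                  ≡⟨ end ⟩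
          x                                  ∎)
          (∈-orbit⁺ (power f x i) (suc k ∸ i) (here refl))
      where open ≡-Reasoning

    -- These are the links inside the list only; the closing step is contained in `orbit-closed`.
    orbit-linked : ∀ x → Linked (λ y z → z ≡ f y) (orbit x)
    orbit-linked x with k , orbit≡ , _ ← orbit-period x =
      subst (Linked _) (sym orbit≡) (iterate-linked x (suc k))
      where
      iterate-linked : ∀ x k → Linked (λ y z → z ≡ f y) (iterate f x k)
      iterate-linked x zero          = []
      iterate-linked x (suc zero)    = [-]
      iterate-linked x (suc (suc k)) = refl ∷ iterate-linked (f x) (suc k)

    -- A repeated entry would yield a shorter period.
    mult-orbit-≤1 : ∀ x y → mult y (orbit x) ≤ 1
    mult-orbit-≤1 x y with k , orbit≡ , _ , before ← orbit-period x =
      subst (λ ys → mult y ys ≤ 1) (sym orbit≡) (mult-iterate x k before)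
      where
      mult-iterate : ∀ x k → (∀ {i} → i < k → power f x (suc i) ≢ x) →
                     mult y (iterate f x (suc k)) ≤ 1
      mult-iterate x k before with y ≟ x
      ... | yes refl = ℕ.≤-reflexive (cong suc (absent (mult y (iterate f (f y) k) ℕ.≟ 0)))
        where
        absent : Dec (mult y (iterate f (f y) k) ≡ 0) → mult y (iterate f (f y) k) ≡ 0
        absent (yes ≡0) = ≡0
        absent (no ≢0) with i , i<k , eq ← ∈-iterate⁻ (f y) k (mult≢0⇒Any (iterate f (f y) k) ≢0) =
          contradiction (sym eq) (before i<k)
      mult-iterate x zero    before | no _ = z≤n
      mult-iterate x (suc k) before | no _ = mult-iterate (f x) k
        -- Minimality of the period passes from `x` to `f x` by cancelling one `f`.
        λ {i} i<k eq → before (ℕ.m≤n⇒m≤1+n i<k) (f-injective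
          (trans (sym (power-suc (suc i) x)) eq))

    module _ (v : A → ℕ) where

      Leading : A → Set a
      Leading x = All (λ y → v y ≤ v x) (orbit x)

      leading? : (x : A) → Dec (Leading x)
      leading? x = All.all? (λ y → v y ℕ.≤? v x) (orbit x)

      module _ (v-injective : ∀ {x y} → v x ≡ v y → x ≡ y) where

        -- Thus the orbits listed from their leading elements partition the set. The one orbit that
        -- contains `x` is listed from its maximum for `v`: two leading elements of one orbit bound
        -- each other, and `v` is injective.
        leading-orbit : (∀ x → mult x xs ≡ 1) → ∀ x →
                        ∑ xs (λ y → ⟦ leading? y ⟧ * mult x (orbit y)) ≡ 1
        leading-orbit once x = trans
          (∑-cong xs λ y → only-leader y (leading? y) (leader ≟ y)) (once leader)
          where
          -- The default value `x` of `argmax` lies on its own orbit, so the maximum does too.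
          leader : A
          leader = argmax v x (orbit x)

          leader∈ : leader ∈ˡ orbit x
          leader∈ = argmax-all v (here refl) (All.tabulate id)

          leading : Leading leader
          leading = All.tabulate λ y∈ →
            All.lookup (f[xs]≤f[argmax] {f = v} x (orbit x)) (∈-orbit-trans leader∈ y∈)

          only-leader : ∀ y (y? : Dec (Leading y)) (l? : Dec (leader ≡ y)) →
                        ⟦ y? ⟧ * mult x (orbit y) ≡ ⟦ l? ⟧
          only-leader y (no ¬y) (yes refl) = contradiction leading ¬y
          only-leader y (no ¬y) (no _)     = refl
          only-leader y (yes _) (yes refl) = trans (ℕ.*-identityˡ _)
            (ℕ.≤-antisym (mult-orbit-≤1 leader x)
              (ℕ.n≢0⇒n>0 (Any⇒mult≢0 (∈-orbit-sym leader∈))))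
          only-leader y (yes y-leading) (no l≢y) with mult x (orbit y) ℕ.≟ 0
          ... | yes ≡0 = trans (ℕ.*-identityˡ _) ≡0
          ... | no  ≢0 = contradiction
            (v-injective (ℕ.≤-antisym (All.lookup y-leading l∈y)
              (All.lookup leading (∈-orbit-sym l∈y)))) l≢y
            where
            l∈y : leader ∈ˡ orbit y
            l∈y = ∈-orbit-trans (mult≢0⇒Any (orbit y) ≢0) leader∈

  -- Permutations acting on labelled graphs

  module _ (S : DecSetoid a ℓ) where

    open DecSetoid S using (Carrier; _≈_) renaming (_≟_ to _≈?_; sym to ≈-sym)
    open Multiplicity S

    -- `to` and `from` make `ψ` an inverse of `φ` up to `_≈_`. No permutation of the list is
    -- constructed: inserting the delta `φ x ≈? y` and exchanging the sums turns it into `ψ y ≈? x`,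
    -- which again sums to 1.
    ∑-reindex : (xs : List Carrier) → (∀ y → mult y xs ≡ 1) →
                (φ ψ : Carrier → Carrier) →
                (∀ {x y} → φ x ≈ y → ψ y ≈ x) → (∀ {x y} → ψ y ≈ x → φ x ≈ y) →
                (f : Carrier → ℕ) → (∀ {x y} → x ≈ y → f x ≡ f y) →
                ∑ xs (f ∘ φ) ≡ ∑ xs f
    ∑-reindex xs once φ ψ to from f f-cong = begin
      ∑ xs (λ x → f (φ x))
        ≡⟨ ∑-cong xs (λ x → sym (trans (cong (_* f (φ x)) (once (φ x))) (ℕ.*-identityˡ _))) ⟩
      ∑ xs (λ x → mult (φ x) xs * f (φ x))
        ≡⟨ ∑-cong xs (λ x → sym (∑-pick (φ x) xs (f-cong ∘ ≈-sym))) ⟩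
      ∑ xs (λ x → ∑ xs (λ y → ⟦ φ x ≈? y ⟧ * f y))
        ≡⟨ ∑-swap xs xs _ ⟩
      ∑ xs (λ y → ∑ xs (λ x → ⟦ φ x ≈? y ⟧ * f y))
        ≡⟨ ∑-cong xs (λ y → trans (∑-*ʳ xs _ (f y)) (cong (_* f y)
             (∑-cong xs (λ x → ⟦⟧-⇔ (φ x ≈? y) (ψ y ≈? x) to from)))) ⟩
      ∑ xs (λ y → mult (ψ y) xs * f y)
        ≡⟨ ∑-cong xs (λ y → trans (cong (_* f y) (once (ψ y))) (ℕ.*-identityˡ (f y))) ⟩
      ∑ xs f ∎
      where open ≡-Reasoning

  permutationDecSetoid : ℕ → DecSetoid 0ℓ 0ℓ
  permutationDecSetoid n = record
    { Carrier          = Permutation′ n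
    ; _≈_              = Perm._≈_
    ; isDecEquivalence = record
      { isEquivalence = Setoid.isEquivalence (permutationSetoid n)
      ; _≟_           = λ α β → Fin.all? λ i → (α ⟨$⟩ʳ i) Fin.≟ (β ⟨$⟩ʳ i)
      }
    }

  graphDecSetoid : ℕ → DecSetoid 0ℓ 0ℓ
  graphDecSetoid n = record
    { Carrier          = Graph n
    ; _≈_              = _≗_
    ; isDecEquivalence = record
      { isEquivalence = record
        { refl  = λ _ → refl
        ; sym   = λ G≗H e → sym (G≗H e)
        ; trans = λ G≗H H≗K e → trans (G≗H e) (H≗K e)
        }
      ; _≟_           = λ G H → map′
          (λ all e → All.lookup all (∈-edges e)) (λ G≗H → All.universal G≗H (edges n))
          (All.all? (λ e → G e Bool.≟ H e) (edges n))
      }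
    }

  module Permutations {n} = Multiplicity (permutationDecSetoid n)
  module Graphs {n} = Multiplicity (graphDecSetoid n)
  open module PermutationEq {n} = DecSetoid (permutationDecSetoid n)
    using () renaming (_≟_ to _≈?_)
  open module GraphEq {n} = DecSetoid (graphDecSetoid n)
    using () renaming (_≟_ to _≗?_; sym to ≗-sym; trans to ≗-trans)

  ∑-allFin : (i : Fin n) → ∑ (allFin n) (λ j → ⟦ i Fin.≟ j ⟧) ≡ 1
  ∑-allFin {suc n} i = begin
    ⟦ i Fin.≟ zero ⟧ + ∑ (tabulate suc) (λ j → ⟦ i Fin.≟ j ⟧)
      ≡⟨ cong (λ js → ⟦ i Fin.≟ zero ⟧ + ∑ js (λ j → ⟦ i Fin.≟ j ⟧)) (sym (map-tabulate id suc)) ⟩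
    ⟦ i Fin.≟ zero ⟧ + ∑ (map suc (allFin n)) (λ j → ⟦ i Fin.≟ j ⟧)
      ≡⟨ cong (⟦ i Fin.≟ zero ⟧ +_) (∑-map suc (allFin n) _) ⟩
    ⟦ i Fin.≟ zero ⟧ + ∑ (allFin n) (λ j → ⟦ i Fin.≟ suc j ⟧)
      ≡⟨ lemma i ⟩
    1 ∎
    where
    open ≡-Reasoning
    lemma : ∀ i → ⟦ i Fin.≟ zero ⟧ + ∑ (allFin n) (λ j → ⟦ i Fin.≟ suc j ⟧) ≡ 1
    lemma zero    = cong suc (trans (∑-const (allFin n) 0) (ℕ.*-zeroʳ (length (allFin n))))
    lemma (suc i) = trans (∑-cong (allFin n) λ j →
      ⟦⟧-⇔ (suc i Fin.≟ suc j) (i Fin.≟ j) Fin.suc-injective (cong suc)) (∑-allFin i)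

  -- With its converse `insert≈`, this splits equality with an entry of `permutations (suc n)` into
  -- two independent conditions, so the double sum in `mult-permutations` factors.
  ≈insert : {α : Permutation′ (suc n)} {j : Fin (suc n)} {π : Permutation′ n} →
            α Perm.≈ insert zero j π → α ⟨$⟩ʳ zero ≡ j × remove zero α Perm.≈ π
  ≈insert {α = α} {j} {π} α≈ = α≈ zero , λ k → Fin.punchIn-injective j _ _ (begin
    punchIn j (remove zero α ⟨$⟩ʳ k)
      ≡⟨ cong (λ i → punchIn i (remove zero α ⟨$⟩ʳ k)) (α≈ zero) ⟨
    punchIn (α ⟨$⟩ʳ zero) (remove zero α ⟨$⟩ʳ k)   ≡⟨ punchIn-permute α zero k ⟨
    α ⟨$⟩ʳ suc k                                   ≡⟨ α≈ (suc k) ⟩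
    insert zero j π ⟨$⟩ʳ suc k                     ≡⟨ insert-punchIn zero j π k ⟩
    punchIn j (π ⟨$⟩ʳ k)                           ∎)
    where open ≡-Reasoning

  insert≈ : {α : Permutation′ (suc n)} {j : Fin (suc n)} {π : Permutation′ n} →
            α ⟨$⟩ʳ zero ≡ j → remove zero α Perm.≈ π → α Perm.≈ insert zero j π
  insert≈ refl α∖0≈π zero    = refl
  insert≈ {α = α} {π = π} refl α∖0≈π (suc k) = begin
    α ⟨$⟩ʳ suc k                                  ≡⟨ punchIn-permute α zero k ⟩
    punchIn (α ⟨$⟩ʳ zero) (remove zero α ⟨$⟩ʳ k)  ≡⟨ cong (punchIn _) (α∖0≈π k) ⟩
    punchIn (α ⟨$⟩ʳ zero) (π ⟨$⟩ʳ k)              ≡⟨ insert-punchIn zero (α ⟨$⟩ʳ zero) π k ⟨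
    insert zero (α ⟨$⟩ʳ zero) π ⟨$⟩ʳ suc k        ∎
    where open ≡-Reasoning

  mult-permutations : (α : Permutation′ n) → Permutations.mult α (permutations n) ≡ 1
  mult-permutations {zero}  α = ⟦⟧-true (α ≈? Perm.id) λ ()
  mult-permutations {suc n} α = begin
    ∑ (permutations (suc n)) (λ β → ⟦ α ≈? β ⟧)
      ≡⟨ ∑-cartesianProductWith (insert zero) (allFin (suc n)) (permutations n) _ ⟩
    ∑ (allFin (suc n)) (λ j → ∑ (permutations n) (λ π → ⟦ α ≈? insert zero j π ⟧))
      ≡⟨ ∑-cong (allFin (suc n)) (λ j → ∑-cong (permutations n) (λ π →
           ⟦×⟧ ((α ⟨$⟩ʳ zero) Fin.≟ j) (remove zero α ≈? π) (α ≈? insert zero j π)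
             (≈insert {α = α}) (insert≈ {α = α}))) ⟩
    ∑ (allFin (suc n)) (λ j → ∑ (permutations n) (λ π →
      ⟦ (α ⟨$⟩ʳ zero) Fin.≟ j ⟧ * ⟦ remove zero α ≈? π ⟧))
      ≡⟨ ∑-cong (allFin (suc n)) (λ j → trans
           (∑-*ˡ (permutations n) ⟦ (α ⟨$⟩ʳ zero) Fin.≟ j ⟧ _)
           (cong (⟦ (α ⟨$⟩ʳ zero) Fin.≟ j ⟧ *_) (mult-permutations (remove zero α)))) ⟩
    ∑ (allFin (suc n)) (λ j → ⟦ (α ⟨$⟩ʳ zero) Fin.≟ j ⟧ * 1)
      ≡⟨ ∑-cong (allFin (suc n)) (λ j → ℕ.*-identityʳ _) ⟩
    ∑ (allFin (suc n)) (λ j → ⟦ (α ⟨$⟩ʳ zero) Fin.≟ j ⟧)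
      ≡⟨ ∑-allFin (α ⟨$⟩ʳ zero) ⟩
    1 ∎
    where open ≡-Reasoning

  length-permutations : ∀ n → length (permutations n) ≡ n !
  length-permutations zero    = refl
  length-permutations (suc n) = begin
    length (permutations (suc n))
      ≡⟨ length-∑ (permutations (suc n)) ⟩
    ∑ (permutations (suc n)) (λ _ → 1)
      ≡⟨ ∑-cartesianProductWith (insert zero) (allFin (suc n)) (permutations n) _ ⟩
    ∑ (allFin (suc n)) (λ _ → ∑ (permutations n) (λ _ → 1))
      ≡⟨ ∑-const (allFin (suc n)) _ ⟩
    length (allFin (suc n)) * ∑ (permutations n) (λ _ → 1)
      ≡⟨ cong₂ _*_ (length-tabulate {n = suc n} id)
           (trans (sym (length-∑ (permutations n))) (length-permutations n)) ⟩
    suc n * n ! ∎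
    where open ≡-Reasoning

  ·-congʳ : {α β : Permutation′ n} (G : Graph n) → α Perm.≈ β → α · G ≗ β · G
  ·-congʳ {α = α} {β} G α≈β e = begin
    (α · G) e          ≡⟨ cong (α · G) (′-inverseʳ α e) ⟨
    (α · G) ((α ′) f)  ≡⟨ ·-apply α G f ⟩
    G f                ≡⟨ ·-apply β G f ⟨
    (β · G) ((β ′) f)  ≡⟨ cong (β · G) (pair-cong (α≈β (lo f)) (α≈β (hi f))) ⟨
    (β · G) ((α ′) f)  ≡⟨ cong (β · G) (′-inverseʳ α e) ⟩
    (β · G) e          ∎
    where
    open ≡-Reasoning
    f = (flip α ′) e

  ·-∘ₚ : (α β : Permutation′ n) (G : Graph n) → β · (α · G) ≗ (α ∘ₚ β) · G
  ·-∘ₚ α β G = proj₂ (Isomorphic-trans {G = G} (α , λ _ → refl) (β , λ _ → refl))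

  ·-injective : (α : Permutation′ n) {G H : Graph n} → α · G ≗ α · H → G ≗ H
  ·-injective α {G} {H} αG≗αH e =
    trans (sym (·-apply α G e)) (trans (αG≗αH ((α ′) e)) (·-apply α H e))

  ·-complement : (α : Permutation′ n) (G : Graph n) →
                 α · complement G ≗ complement (α · G)
  ·-complement α G e = begin
    (α · complement G) e          ≡⟨ cong (α · complement G) (′-inverseʳ α e) ⟨
    (α · complement G) ((α ′) f)  ≡⟨ ·-apply α (complement G) f ⟩
    not (G f)                     ≡⟨ cong not (·-apply α G f) ⟨
    not ((α · G) ((α ′) f))       ≡⟨ cong (not ∘ (α · G)) (′-inverseʳ α e) ⟩
    not ((α · G) e)               ∎
    where
    open ≡-Reasoning
    f = (flip α ′) e

  -- Serves both as the order of `Γ G`, when `H` is `G`, and as the coefficient of `U n` at the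
  -- weight of `G`, when `H` is the complement.
  transporters : Graph n → Graph n → ℕ
  transporters {n} G H = ∑ (permutations n) λ α → ⟦ (α · G) ≗? H ⟧

  ∑-permutations-reindex :
    (φ ψ : Permutation′ n → Permutation′ n) →
    (∀ {α β} → φ α Perm.≈ β → ψ β Perm.≈ α) → (∀ {α β} → ψ β Perm.≈ α → φ α Perm.≈ β) →
    (G H : Graph n) →
    ∑ (permutations n) (λ α → ⟦ (φ α · G) ≗? H ⟧) ≡ transporters G H
  ∑-permutations-reindex φ ψ to from G H =
    ∑-reindex (permutationDecSetoid _) (permutations _) mult-permutations φ ψ
      (λ {α} {β} → to {α} {β}) (λ {α} {β} → from {α} {β}) _
      λ {α} {β} α≈β → ⟦⟧-⇔ ((α · G) ≗? H) ((β · G) ≗? H)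
        (≗-trans (≗-sym (·-congʳ {α = α} {β} G α≈β))) (≗-trans (·-congʳ {α = α} {β} G α≈β))

  -- Following an automorphism of `G` by `β` gives exactly the permutations that carry `G` to `H`.
  transporters-isomorphic : {G H : Graph n} → Isomorphic G H →
                            transporters G H ≡ transporters G G
  transporters-isomorphic {n} {G} {H} (β , H≗βG) = begin
    transporters G H
      ≡⟨ ∑-permutations-reindex (_∘ₚ β) (_∘ₚ flip β)
           (λ αβ≈γ i → trans (cong (flip β ⟨$⟩ʳ_) (sym (αβ≈γ i))) (Perm.inverseˡ β))
           (λ γβ⁻¹≈α i → trans (cong (β ⟨$⟩ʳ_) (sym (γβ⁻¹≈α i))) (Perm.inverseʳ β)) G H ⟨
    ∑ (permutations n) (λ α → ⟦ ((α ∘ₚ β) · G) ≗? H ⟧)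
      ≡⟨ ∑-cong (permutations n) (λ α → ⟦⟧-⇔ (((α ∘ₚ β) · G) ≗? H) ((α · G) ≗? G)
           (λ αβG≗H → ·-injective β {α · G} {G} (≗-trans (·-∘ₚ α β G) (≗-trans αβG≗H H≗βG)))
           (λ αG≗G → ≗-trans (≗-sym (·-∘ₚ α β G))
                       (≗-trans (·-cong β αG≗G) (≗-sym H≗βG)))) ⟩
    transporters G G ∎
    where open ≡-Reasoning

  -- Instead of conjugating by `β`, both stabilisers are matched with the permutations carrying `G`
  -- to `H`: here `β` is applied before an automorphism of `H`.
  transporters-stabiliser : {G H : Graph n} → Isomorphic G H →
                            transporters H H ≡ transporters G G
  transporters-stabiliser {n} {G} {H} G≅H@(β , H≗βG) = begin
    transporters H H
      ≡⟨ ∑-cong (permutations n) (λ α →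
           ⟦⟧-⇔ ((α · H) ≗? H) (((β ∘ₚ α) · G) ≗? H)
             (λ αH≗H e → trans (sym (αH≗βαG α e)) (αH≗H e))
             (λ βαG≗H e → trans (αH≗βαG α e) (βαG≗H e))) ⟩
    ∑ (permutations n) (λ α → ⟦ ((β ∘ₚ α) · G) ≗? H ⟧)
      ≡⟨ ∑-permutations-reindex (β ∘ₚ_) (flip β ∘ₚ_)
           (λ {α} βα≈γ i → trans (sym (βα≈γ _)) (cong (α ⟨$⟩ʳ_) (Perm.inverseʳ β)))
           (λ {α} {γ} β⁻¹γ≈α i → trans (sym (β⁻¹γ≈α _)) (cong (γ ⟨$⟩ʳ_) (Perm.inverseˡ β))) G H ⟩
    transporters G H
      ≡⟨ transporters-isomorphic {G = G} {H} G≅H ⟩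
    transporters G G ∎
    where
    open ≡-Reasoning
    αH≗βαG : ∀ α → α · H ≗ (β ∘ₚ α) · G
    αH≗βαG α e = trans (·-cong α {H} {β · G} H≗βG e) (·-∘ₚ β α G e)

  Γ-cardinality : (G : Graph n) → Γ G HasCardinality transporters G G
  Γ-cardinality {n} G =
    subst (Γ G HasCardinality_) (length-filter-∑ (λ α → (α · G) ≗? G) (permutations n))
      (Permutations.cardinality (filter (λ α → (α · G) ≗? G) (permutations n))
        (All.all-filter (λ α → (α · G) ≗? G) (permutations n))
        λ α αG≗G → trans
          (Permutations.mult-filter (λ α → (α · G) ≗? G) {y = α} (permutations n)
            λ {β} α≈β → ≗-trans (≗-sym (·-congʳ {α = α} {β} G α≈β)) αG≗G)
          (mult-permutations α))

  Isomorphic? : (G H : Graph n) → Dec (Isomorphic G H)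
  Isomorphic? {n} G H = map′ to from (Any.any? (λ α → H ≗? (α · G)) (permutations n))
    where
    to : Any (λ α → H ≗ α · G) (permutations n) → Isomorphic G H
    to any = Any.satisfied any
    from : Isomorphic G H → Any (λ α → H ≗ α · G) (permutations n)
    from (α , H≗αG) = Any.map
      (λ {β} α≈β → ≗-trans H≗αG (·-congʳ {α = α} {β} G α≈β))
      (Permutations.mult≢0⇒Any {y = α} (permutations n)
        λ eq → ℕ.1+n≢0 (trans (sym (mult-permutations α)) eq))

  isomorphismDecSetoid : ℕ → DecSetoid 0ℓ 0ℓ
  isomorphismDecSetoid n = record
    { Carrier          = Graph n
    ; _≈_              = Isomorphic
    ; isDecEquivalence = record
      { isEquivalence = Setoid.isEquivalence (isomorphismSetoid n)
      ; _≟_           = Isomorphic?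
      }
    }

  module IsomorphismClasses {n} = Multiplicity (isomorphismDecSetoid n)

  -- After `nub`, completeness of the list already gives multiplicity 1.
  graphs : ∀ n → List (Graph n)
  graphs n = Graphs.nub (subgraphs (edges n))

  mult-graphs : (G : Graph n) → Graphs.mult G (graphs n) ≡ 1
  mult-graphs {n} G =
    Graphs.mult-nub (subgraphs (edges n)) (∈-subgraphs (edges n) G λ e _ → ∈-edges e)

  -- Binary expansions and the weights of edges

  open module EdgeMultiplicity {n} = Multiplicity (decSetoid (_≟_ {n}))

  mult-edges : (e : Edge n) → mult e (edges n) ≡ 1
  mult-edges {n} e@(edge i j i<j) = begin
    ∑ (edges n) (λ f → ⟦ e ≟ f ⟧)
      ≡⟨ ∑-mapMaybe (uncurry edge?) (cartesianProduct (allFin n) (allFin n)) _ ⟩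
    ∑ (cartesianProduct (allFin n) (allFin n)) (maybe (λ f → ⟦ e ≟ f ⟧) 0 ∘ uncurry edge?)
      ≡⟨ ∑-cartesianProductWith _,_ (allFin n) (allFin n) _ ⟩
    ∑ (allFin n) (λ a → ∑ (allFin n) (λ b → maybe (λ f → ⟦ e ≟ f ⟧) 0 (edge? a b)))
      ≡⟨ ∑-cong (allFin n) (λ a → ∑-cong (allFin n) (lemma a)) ⟩
    ∑ (allFin n) (λ a → ∑ (allFin n) (λ b → ⟦ i Fin.≟ a ⟧ * ⟦ j Fin.≟ b ⟧))
      ≡⟨ ∑-cong (allFin n) (λ a → trans (∑-*ˡ (allFin n) ⟦ i Fin.≟ a ⟧ _)
           (trans (cong (⟦ i Fin.≟ a ⟧ *_) (∑-allFin j)) (ℕ.*-identityʳ _))) ⟩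
    ∑ (allFin n) (λ a → ⟦ i Fin.≟ a ⟧)
      ≡⟨ ∑-allFin i ⟩
    1 ∎
    where
    open ≡-Reasoning
    open Edges n
    lemma : ∀ a b → maybe (λ f → ⟦ e ≟ f ⟧) 0 (edge? a b) ≡ ⟦ i Fin.≟ a ⟧ * ⟦ j Fin.≟ b ⟧
    lemma a b with a Fin.<? b
    ... | yes a<b = ⟦×⟧ (i Fin.≟ a) (j Fin.≟ b) (e ≟ edge a b a<b)
                      (λ { refl → refl , refl }) (λ { refl refl → refl })
    ... | no  a≮b with i Fin.≟ a | j Fin.≟ b
    ...   | yes refl | yes refl = ⊥-elim-irr (a≮b i<j)
    ...   | yes _    | no _     = refl
    ...   | no _     | _        = refl

  -- Digits are arbitrary naturals, lowest first, so that the value is additive in them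
  -- (`binary-∑`); the bound 1 is imposed only for `binary-injective`.
  binary : (ℕ → ℕ) → ℕ → ℕ
  binary b zero    = 0
  binary b (suc k) = b 0 + 2 * binary (b ∘ suc) k

  -- The lowest digit is the parity; removing it and halving leaves one digit fewer.
  binary-injective : ∀ k {b c : ℕ → ℕ} → (∀ i → b i ≤ 1) → (∀ i → c i ≤ 1) →
                     binary b k ≡ binary c k → ∀ {i} → i < k → b i ≡ c i
  binary-injective (suc k) {b} {c} b≤1 c≤1 eq {i} i<k
    with b 0 in b₀ | b≤1 0 | c 0 in c₀ | c≤1 0 | i | i<k
  ... | 0 | _ | 0 | _ | zero  | _ = trans b₀ (sym c₀)
  ... | 0 | _ | 0 | _ | suc i | s≤s i<k =
    binary-injective k (b≤1 ∘ suc) (c≤1 ∘ suc) (ℕ.*-cancelˡ-≡ _ _ 2 eq) i<k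
  ... | 1 | _ | 1 | _ | zero  | _ = trans b₀ (sym c₀)
  ... | 1 | _ | 1 | _ | suc i | s≤s i<k =
    binary-injective k (b≤1 ∘ suc) (c≤1 ∘ suc) (ℕ.*-cancelˡ-≡ _ _ 2 (ℕ.suc-injective eq)) i<k
  ... | 0 | _ | 1 | _ | _ | _ =
    contradiction eq (ℕ.even≢odd (binary (b ∘ suc) k) (binary (c ∘ suc) k))
  ... | 1 | _ | 0 | _ | _ | _ =
    contradiction (sym eq) (ℕ.even≢odd (binary (c ∘ suc) k) (binary (b ∘ suc) k))
  ... | suc (suc _) | s≤s () | _ | _ | _ | _
  ... | 0 | _ | suc (suc _) | s≤s () | _ | _
  ... | 1 | _ | suc (suc _) | s≤s () | _ | _

  binary-0 : ∀ k {b : ℕ → ℕ} → (∀ i → b i ≡ 0) → binary b k ≡ 0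
  binary-0 zero    b≡0 = refl
  binary-0 (suc k) b≡0 = cong₂ (λ x y → x + 2 * y) (b≡0 0) (binary-0 k (b≡0 ∘ suc))

  binary-∑ : ∀ k (xs : List A) (f : A → ℕ → ℕ) →
             binary (λ i → ∑ xs (λ x → f x i)) k ≡ ∑ xs (λ x → binary (f x) k)
  binary-∑ zero    xs f = sym (trans (∑-const xs 0) (ℕ.*-zeroʳ (length xs)))
  binary-∑ (suc k) xs f = begin
    ∑ xs (λ x → f x 0) + 2 * binary (λ i → ∑ xs (λ x → f x (suc i))) k
      ≡⟨ cong (λ y → ∑ xs (λ x → f x 0) + 2 * y) (binary-∑ k xs (λ x → f x ∘ suc)) ⟩
    ∑ xs (λ x → f x 0) + 2 * ∑ xs (λ x → binary (f x ∘ suc) k)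
      ≡⟨ cong (∑ xs (λ x → f x 0) +_) (∑-*ˡ xs 2 _) ⟨
    ∑ xs (λ x → f x 0) + ∑ xs (λ x → 2 * binary (f x ∘ suc) k)
      ≡⟨ ∑-+ xs _ _ ⟨
    ∑ xs (λ x → f x 0 + 2 * binary (f x ∘ suc) k) ∎
    where open ≡-Reasoning

  binary-power : ∀ k m {j} → j < k → binary (λ i → m * ⟦ j ℕ.≟ i ⟧) k ≡ m * 2 ^ j
  binary-power (suc k) m {zero}  _ =
    trans (cong (λ x → m * 1 + 2 * x) (binary-0 k λ _ → ℕ.*-zeroʳ m)) (ℕ.+-identityʳ (m * 1))
  binary-power (suc k) m {suc j} (s≤s j<k) =
    trans (cong₂ (λ x y → x + 2 * y) (ℕ.*-zeroʳ m) (binary-power k m j<k)) (shift m (2 ^ j))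
    where
    shift : ∀ m k → 2 * (m * k) ≡ m * (2 * k)
    shift = solve-∀

  -- The first summand of `p`, with vertices numbered from 0. For `i` up to `n` it counts the edges
  -- whose smaller endpoint lies below `i`.
  row : ℕ → ℕ → ℕ
  row n i = (2 * n ∸ suc i) * i / 2

  -- Writing the order as `suc i + m` removes the truncated subtractions. The numerator then grows
  -- by `m * 2`, and a multiple of 2 splits off from the floor division whatever the parity of the
  -- rest.
  row-suc : ∀ i m → row (suc i + m) (suc i) ≡ row (suc i + m) i + m
  row-suc i m = begin
    (2 * (suc i + m) ∸ suc (suc i)) * suc i / 2
      ≡⟨ cong (λ x → x * suc i / 2)
           (trans (cong (_∸ suc (suc i)) (double i m)) (ℕ.m+n∸m≡n (suc (suc i)) _)) ⟩
    (i + 2 * m) * suc i / 2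
      ≡⟨ cong (_/ 2) (expand i m) ⟩
    ((suc i + 2 * m) * i + m * 2) / 2
      ≡⟨ +-distrib-/-∣ʳ ((suc i + 2 * m) * i) (n∣m*n m) ⟩
    (suc i + 2 * m) * i / 2 + m * 2 / 2
      ≡⟨ cong₂ (λ x y → x * i / 2 + y)
           (sym (trans (cong (_∸ suc i) (double′ i m)) (ℕ.m+n∸m≡n (suc i) _))) (m*n/n≡m m 2) ⟩
    (2 * (suc i + m) ∸ suc i) * i / 2 + m ∎
    where
    open ≡-Reasoning
    double : ∀ i m → 2 * (suc i + m) ≡ suc (suc i) + (i + 2 * m)
    double = solve-∀
    double′ : ∀ i m → 2 * (suc i + m) ≡ suc i + (suc i + 2 * m)
    double′ = solve-∀
    expand : ∀ i m → (i + 2 * m) * suc i ≡ (suc i + 2 * m) * i + m * 2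
    expand = solve-∀

  row-step : ∀ {i} → i < n → row n (suc i) ≡ row n i + (n ∸ suc i)
  row-step {n} {i} i<n =
    subst (λ k → row k (suc i) ≡ row k i + (n ∸ suc i)) (ℕ.m+[n∸m]≡n i<n) (row-suc i (n ∸ suc i))

  row-mono : ∀ {i j} → i ≤ j → j ≤ n → row n i ≤ row n j
  row-mono {j = zero}  z≤n _ = ℕ.≤-refl
  row-mono {n} {i} {suc j} i≤1+j 1+j≤n with ℕ.m≤n⇒m<n∨m≡n i≤1+j
  ... | inj₂ refl = ℕ.≤-refl
  ... | inj₁ i<1+j = ℕ.≤-trans (row-mono (ℕ.≤-pred i<1+j) (ℕ.<⇒≤ 1+j≤n))
    (ℕ.≤-trans (ℕ.m≤m+n (row n j) _) (ℕ.≤-reflexive (sym (row-step 1+j≤n))))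

  -- Bounds `p` by `n C 2`, so that the subtraction in the exponent of `w` is never truncated.
  row-last : ∀ n → row n n ≡ n C 2
  row-last zero    = refl
  row-last (suc n) = trans
    (cong (λ x → x * suc n / 2)
      (trans (cong (_∸ suc (suc n)) (double n)) (ℕ.m+n∸m≡n (suc (suc n)) n)))
    (sym ([1+n]C2 n))
    where
    double : ∀ n → 2 * suc n ≡ suc (suc n) + n
    double = solve-∀
    [1+n]C2 : ∀ n → suc n C 2 ≡ n * suc n / 2
    [1+n]C2 zero    = refl
    [1+n]C2 (suc n) = begin
      suc (suc n) C 2               ≡⟨ nCk+nC[k+1]≡[n+1]C[k+1] (suc n) 1 ⟨
      suc n C 1 + suc n C 2         ≡⟨ cong₂ _+_ (nC1≡n (suc n)) ([1+n]C2 n) ⟩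
      suc n + n * suc n / 2         ≡⟨ ℕ.+-comm (suc n) _ ⟩
      n * suc n / 2 + suc n         ≡⟨ cong (n * suc n / 2 +_) (m*n/n≡m (suc n) 2) ⟨
      n * suc n / 2 + suc n * 2 / 2 ≡⟨ +-distrib-/-∣ʳ (n * suc n) (n∣m*n (suc n)) ⟨
      (n * suc n + suc n * 2) / 2   ≡⟨ cong (_/ 2) (expand n) ⟩
      suc n * suc (suc n) / 2       ∎
      where
      open ≡-Reasoning
      expand : ∀ n → n * suc n + suc n * 2 ≡ suc n * suc (suc n)
      expand = solve-∀

  lo<hi-relevant : (e : Edge n) → toℕ (lo e) < toℕ (hi e)
  lo<hi-relevant (edge i j i<j) = recompute (i Fin.<? j) i<j

  row<p : (e : Edge n) → row n (toℕ (lo e)) < p e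
  row<p {n} e = ℕ.m<m+n (row n (toℕ (lo e))) (ℕ.m<n⇒0<n∸m (lo<hi-relevant e))

  p≤row : (e : Edge n) → p e ≤ row n (suc (toℕ (lo e)))
  p≤row {n} e = ℕ.≤-trans
    (ℕ.+-monoʳ-≤ (row n (toℕ (lo e))) (ℕ.∸-monoˡ-≤ (suc (toℕ (lo e))) (Fin.toℕ<n (hi e))))
    (ℕ.≤-reflexive (sym (row-step (Fin.toℕ<n (lo e)))))

  p≤nC2 : (e : Edge n) → p e ≤ n C 2
  p≤nC2 {n} e = ℕ.≤-trans (p≤row e)
    (ℕ.≤-trans (row-mono (Fin.toℕ<n (lo e)) ℕ.≤-refl) (ℕ.≤-reflexive (row-last n)))

  -- The values of `p` at smaller endpoint `i` lie above `row n i` and do not exceed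
  -- `row n (suc i)`; these blocks are disjoint and ordered.
  p-mono-lo : (e f : Edge n) → toℕ (lo e) < toℕ (lo f) → p e < p f
  p-mono-lo e f lo<lo = ℕ.≤-<-trans (p≤row e)
    (ℕ.≤-<-trans (row-mono lo<lo (ℕ.<⇒≤ (Fin.toℕ<n (lo f)))) (row<p f))

  p-injective : (e f : Edge n) → p e ≡ p f → e ≡ f
  p-injective {n} e f eq with Fin.<-cmp (lo e) (lo f)
  ... | tri< lo<lo _ _ = contradiction eq (ℕ.<⇒≢ (p-mono-lo e f lo<lo))
  ... | tri> _ _ lo<lo = contradiction (sym eq) (ℕ.<⇒≢ (p-mono-lo f e lo<lo))
  ... | tri≈ _ lo≡lo _ = Edge-≡ lo≡lo (Fin.toℕ-injective (ℕ.∸-cancelʳ-≡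
    (ℕ.<⇒≤ (lo<hi-relevant e))
    (subst (λ i → toℕ i ≤ toℕ (hi f)) (sym lo≡lo) (ℕ.<⇒≤ (lo<hi-relevant f)))
    (ℕ.+-cancelˡ-≡ (row n (toℕ (lo e))) _ _ (trans eq
      (cong (λ i → row n (toℕ i) + (toℕ (hi f) ∸ toℕ i)) (sym lo≡lo))))))

  exponent : Edge n → ℕ
  exponent {n} e = n C 2 ∸ p e

  exponent-injective : (e f : Edge n) → exponent e ≡ exponent f → e ≡ f
  exponent-injective e f eq = p-injective e f (ℕ.∸-cancelˡ-≡ (p≤nC2 e) (p≤nC2 f) eq)

  module _ (m : Edge n → ℕ) (m≤1 : ∀ e → m e ≤ 1) where

    -- The coefficient of `2 ^ k` in the weighted sum: `m e` for the one edge `e` of exponent `k`,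
    -- and 0 if there is none.
    digit : ℕ → ℕ
    digit k = ∑ (edges n) λ e → m e * ⟦ exponent e ℕ.≟ k ⟧

    digit-exponent : ∀ e → digit (exponent e) ≡ m e
    digit-exponent e = begin
      ∑ (edges n) (λ f → m f * ⟦ exponent f ℕ.≟ exponent e ⟧)
        ≡⟨ ∑-cong (edges n) (λ f → trans (ℕ.*-comm (m f) _) (cong (_* m f)
             (⟦⟧-⇔ (exponent f ℕ.≟ exponent e) (e ≟ f)
               (sym ∘ exponent-injective f e) (λ { refl → refl })))) ⟩
      ∑ (edges n) (λ f → ⟦ e ≟ f ⟧ * m f)
        ≡⟨ ∑-pick e (edges n) (λ { refl → refl }) ⟩
      mult e (edges n) * m e
        ≡⟨ trans (cong (_* m e) (mult-edges e)) (ℕ.*-identityˡ (m e)) ⟩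
      m e ∎
      where open ≡-Reasoning

    digit≤1 : ∀ k → digit k ≤ 1
    digit≤1 k with digit k ℕ.≟ 0
    ... | yes eq = subst (_≤ 1) (sym eq) z≤n
    ... | no ≢0 with e , _ , me≢0 ← ∑≢0 (edges n) _ ≢0
                with refl ← ⟦⟧≢0 (exponent e ℕ.≟ k)
                     (λ eq → me≢0 (trans (cong (m e *_) eq) (ℕ.*-zeroʳ (m e))))
                = subst (_≤ 1) (sym (digit-exponent e)) (m≤1 e)

    -- Exponents are at most `n C 2`, whence the number of digits.
    ∑-w-binary : ∑ (edges n) (λ e → m e * w e) ≡ binary digit (suc (n C 2))
    ∑-w-binary = sym (trans (binary-∑ (suc (n C 2)) (edges n) (λ e k → m e * ⟦ exponent e ℕ.≟ k ⟧))
      (∑-cong (edges n) λ e → binary-power (suc (n C 2)) (m e) (s≤s (ℕ.m∸n≤m (n C 2) (p e)))))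

  ∑-w-injective : {l m : Edge n → ℕ} → (∀ e → l e ≤ 1) → (∀ e → m e ≤ 1) →
                  ∑ (edges n) (λ e → l e * w e) ≡ ∑ (edges n) (λ e → m e * w e) → l ≗ m
  ∑-w-injective {n} {l} {m} l≤1 m≤1 eq e = begin
    l e                          ≡⟨ digit-exponent l l≤1 e ⟨
    digit l l≤1 (exponent e)     ≡⟨ binary-injective (suc (n C 2)) (digit≤1 l l≤1) (digit≤1 m m≤1)
                                     (trans (sym (∑-w-binary l l≤1)) (trans eq (∑-w-binary m m≤1)))
                                     (s≤s (ℕ.m∸n≤m (n C 2) (p e))) ⟩
    digit m m≤1 (exponent e)     ≡⟨ digit-exponent m m≤1 e ⟩
    m e                          ∎
    where open ≡-Reasoning

  -- Brings the weight of a list of edges into the form to which `∑-w-injective` applies.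
  ∑-mult : (es : List (Edge n)) (f : Edge n → ℕ) → ∑ es f ≡ ∑ (edges n) (λ e → mult e es * f e)
  ∑-mult {n} es f = sym (begin
    ∑ (edges n) (λ e → mult e es * f e)
      ≡⟨ ∑-cong (edges n) (λ e → sym (∑-*ʳ es _ (f e))) ⟩
    ∑ (edges n) (λ e → ∑ es (λ x → ⟦ e ≟ x ⟧ * f e))
      ≡⟨ ∑-swap (edges n) es _ ⟩
    ∑ es (λ x → ∑ (edges n) (λ e → ⟦ e ≟ x ⟧ * f e))
      ≡⟨ ∑-cong es (λ x → ∑-cong (edges n) (λ e →
           cong (_* f e) (⟦⟧-⇔ (e ≟ x) (x ≟ e) sym sym))) ⟩
    ∑ es (λ x → ∑ (edges n) (λ e → ⟦ x ≟ e ⟧ * f e))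
      ≡⟨ ∑-cong es (λ x → trans (∑-pick x (edges n) (λ { refl → refl }))
           (trans (cong (_* f x) (mult-edges x)) (ℕ.*-identityˡ (f x)))) ⟩
    ∑ es f ∎)
    where open ≡-Reasoning

  -- Expanding the product over the cycles

  coeff-⊕ : ∀ f g k → coeff (f ⊕ g) k ≡ coeff f k + coeff g k
  coeff-⊕ []      g       k       = refl
  coeff-⊕ (a ∷ f) []      k       = sym (ℕ.+-identityʳ _)
  coeff-⊕ (a ∷ f) (b ∷ g) zero    = refl
  coeff-⊕ (a ∷ f) (b ∷ g) (suc k) = coeff-⊕ f g k

  coeff-map-* : ∀ a f k → coeff (map (a *_) f) k ≡ a * coeff f k
  coeff-map-* a []      k       = sym (ℕ.*-zeroʳ a)
  coeff-map-* a (b ∷ f) zero    = refl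
  coeff-map-* a (b ∷ f) (suc k) = coeff-map-* a f k

  coeff-∷-⊗ : ∀ a f g k → coeff ((a ∷ f) ⊗ g) k ≡ a * coeff g k + coeff (0 ∷ f ⊗ g) k
  coeff-∷-⊗ a f g k = trans (coeff-⊕ (map (a *_) g) (0 ∷ f ⊗ g) k)
    (cong (_+ coeff (0 ∷ f ⊗ g) k) (coeff-map-* a g k))

  coeff-⊕-⊗ : ∀ f f′ g k → coeff ((f ⊕ f′) ⊗ g) k ≡ coeff (f ⊗ g) k + coeff (f′ ⊗ g) k
  coeff-⊕-⊗ []      f′       g k = refl
  coeff-⊕-⊗ (a ∷ f) []       g k = sym (ℕ.+-identityʳ _)
  coeff-⊕-⊗ (a ∷ f) (b ∷ f′) g k = begin
    coeff ((a + b ∷ f ⊕ f′) ⊗ g) k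
      ≡⟨ coeff-∷-⊗ (a + b) (f ⊕ f′) g k ⟩
    (a + b) * coeff g k + coeff (0 ∷ (f ⊕ f′) ⊗ g) k
      ≡⟨ cong ((a + b) * coeff g k +_) (shift k) ⟩
    (a + b) * coeff g k + (coeff (0 ∷ f ⊗ g) k + coeff (0 ∷ f′ ⊗ g) k)
      ≡⟨ interchange a b (coeff g k) _ _ ⟩
    (a * coeff g k + coeff (0 ∷ f ⊗ g) k) + (b * coeff g k + coeff (0 ∷ f′ ⊗ g) k)
      ≡⟨ cong₂ _+_ (coeff-∷-⊗ a f g k) (coeff-∷-⊗ b f′ g k) ⟨
    coeff ((a ∷ f) ⊗ g) k + coeff ((b ∷ f′) ⊗ g) k ∎
    where
    open ≡-Reasoning
    shift : ∀ k → coeff (0 ∷ (f ⊕ f′) ⊗ g) k ≡ coeff (0 ∷ f ⊗ g) k + coeff (0 ∷ f′ ⊗ g) k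
    shift zero    = refl
    shift (suc k) = coeff-⊕-⊗ f f′ g k
    interchange : ∀ a b c x y → (a + b) * c + (x + y) ≡ (a * c + x) + (b * c + y)
    interchange = solve-∀

  -- The hypothesis says that `g` is the generating function of `h` over `xs`; a monomial factor
  -- shifts all its exponents.
  coeff-x^-⊗ : ∀ a g (xs : List A) (h : A → ℕ) →
               (∀ k → coeff g k ≡ ∑ xs (λ x → ⟦ k ℕ.≟ h x ⟧)) →
               ∀ k → coeff ((x^ a) ⊗ g) k ≡ ∑ xs (λ x → ⟦ k ℕ.≟ a + h x ⟧)
  coeff-x^-⊗ zero    g xs h g≡ k = trans (coeff-∷-⊗ 1 [] g k)
    (trans (cong₂ _+_ (ℕ.*-identityˡ _) (constant k)) (trans (ℕ.+-identityʳ _) (g≡ k)))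
    where
    constant : ∀ k → coeff (0 ∷ []) k ≡ 0
    constant zero    = refl
    constant (suc k) = refl
  coeff-x^-⊗ (suc a) g xs h g≡ zero = trans (coeff-∷-⊗ 0 (x^ a) g 0)
    (sym (trans (∑-const xs 0) (ℕ.*-zeroʳ (length xs))))
  coeff-x^-⊗ (suc a) g xs h g≡ (suc k) =
    trans (coeff-∷-⊗ 0 (x^ a) g (suc k)) (coeff-x^-⊗ a g xs h g≡ k)

  coeff-Σₚ : ∀ (xs : List A) (f : A → Poly) k → coeff (Σₚ (map f xs)) k ≡ ∑ xs (λ x → coeff (f x) k)
  coeff-Σₚ []       f k = refl
  coeff-Σₚ (x ∷ xs) f k =
    trans (coeff-⊕ (f x) _ k) (cong (coeff (f x) k +_) (coeff-Σₚ xs f k))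

  -- The terms of the expanded product before like terms are collected; the exponent of the term `c`
  -- is `∑ c w`.
  choices : List (List (Edge n)) → List (List (Edge n))
  choices []       = [ [] ]
  choices (z ∷ zs) = map (P₁ z ++_) (choices zs) ++ map (P₂ z ++_) (choices zs)

  ∑-choices : (z : List (Edge n)) (zs : List (List (Edge n))) (f : ℕ → ℕ) →
              ∑ (choices (z ∷ zs)) (λ c → f (∑ c w)) ≡
              ∑ (choices zs) (λ c → f (W₁ z + ∑ c w)) + ∑ (choices zs) (λ c → f (W₂ z + ∑ c w))
  ∑-choices z zs f = trans (∑-++ (map (P₁ z ++_) (choices zs)) _ _)
    (cong₂ _+_ (shift (P₁ z)) (shift (P₂ z)))
    where
    shift : ∀ es → ∑ (map (es ++_) (choices zs)) (λ c → f (∑ c w)) ≡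
                   ∑ (choices zs) (λ c → f (∑ es w + ∑ c w))
    shift es = trans (∑-map (es ++_) (choices zs) _)
      (∑-cong (choices zs) λ c → cong f (∑-++ es c w))

  coeff-Πₚ : (zs : List (List (Edge n))) → ∀ L →
             coeff (Πₚ (map (λ z → (x^ W₁ z) ⊕ (x^ W₂ z)) zs)) L ≡
             ∑ (choices zs) (λ c → ⟦ L ℕ.≟ ∑ c w ⟧)
  coeff-Πₚ []       zero    = refl
  coeff-Πₚ []       (suc L) = refl
  coeff-Πₚ (z ∷ zs) L = begin
    coeff (((x^ W₁ z) ⊕ (x^ W₂ z)) ⊗ Π) L
      ≡⟨ coeff-⊕-⊗ (x^ W₁ z) (x^ W₂ z) Π L ⟩
    coeff ((x^ W₁ z) ⊗ Π) L + coeff ((x^ W₂ z) ⊗ Π) L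
      ≡⟨ cong₂ _+_ (coeff-x^-⊗ (W₁ z) Π (choices zs) (λ c → ∑ c w) (coeff-Πₚ zs) L)
                   (coeff-x^-⊗ (W₂ z) Π (choices zs) (λ c → ∑ c w) (coeff-Πₚ zs) L) ⟩
    ∑ (choices zs) (λ c → ⟦ L ℕ.≟ W₁ z + ∑ c w ⟧) + ∑ (choices zs) (λ c → ⟦ L ℕ.≟ W₂ z + ∑ c w ⟧)
      ≡⟨ ∑-choices z zs (λ k → ⟦ L ℕ.≟ k ⟧) ⟨
    ∑ (choices (z ∷ zs)) (λ c → ⟦ L ℕ.≟ ∑ c w ⟧) ∎
    where
    open ≡-Reasoning
    Π = Πₚ (map (λ z → (x^ W₁ z) ⊕ (x^ W₂ z)) zs)

  -- For edges this reads `P₁ (x ∷ xs) ≡ x ∷ P₂ xs`, while `P₂ (x ∷ xs)` is `P₁ xs` by definition.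
  -- Prepending an edge thus exchanges the halves, which permits induction one edge at a time.
  everyOther-∷ : (x : A) (xs : List A) → everyOther (x ∷ xs) ≡ x ∷ everyOther (drop 1 xs)
  everyOther-∷ x []       = refl
  everyOther-∷ x (y ∷ xs) = refl

  mult-P₁-P₂ : (e : Edge n) (z : List (Edge n)) → mult e z ≡ mult e (P₁ z) + mult e (P₂ z)
  mult-P₁-P₂ e []       = refl
  mult-P₁-P₂ e (x ∷ xs) = begin
    ⟦ e ≟ x ⟧ + mult e xs                               ≡⟨ cong (⟦ e ≟ x ⟧ +_) (mult-P₁-P₂ e xs) ⟩
    ⟦ e ≟ x ⟧ + (mult e (P₁ xs) + mult e (P₂ xs))       ≡⟨ rotate ⟦ e ≟ x ⟧ _ _ ⟩
    ⟦ e ≟ x ⟧ + mult e (P₂ xs) + mult e (P₁ xs)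
      ≡⟨ cong (λ es → mult e es + mult e (P₁ xs)) (everyOther-∷ x xs) ⟨
    mult e (P₁ (x ∷ xs)) + mult e (P₂ (x ∷ xs))         ∎
    where
    open ≡-Reasoning
    rotate : ∀ k l m → k + (l + m) ≡ k + m + l
    rotate = solve-∀

  P₁-≤ : (e : Edge n) (z : List (Edge n)) → mult e (P₁ z) ≤ mult e z
  P₁-≤ e z = subst (mult e (P₁ z) ≤_) (sym (mult-P₁-P₂ e z)) (ℕ.m≤m+n _ _)

  P₂-≤ : (e : Edge n) (z : List (Edge n)) → mult e (P₂ z) ≤ mult e z
  P₂-≤ e z = subst (mult e (P₂ z) ≤_) (sym (mult-P₁-P₂ e z)) (ℕ.m≤n+m _ _)

  mult-++ : (e : Edge n) (xs ys : List (Edge n)) → mult e (xs ++ ys) ≡ mult e xs + mult e ys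
  mult-++ e xs ys = ∑-++ xs ys _

  ∈-choices⁻ : (z : List (Edge n)) (zs : List (List (Edge n))) {c : List (Edge n)} →
               c ∈ˡ choices (z ∷ zs) →
               ∃ λ c′ → c′ ∈ˡ choices zs × (c ≡ P₁ z ++ c′ ⊎ c ≡ P₂ z ++ c′)
  ∈-choices⁻ z zs c∈ with ∈-++⁻ (map (P₁ z ++_) (choices zs)) c∈
  ... | inj₁ c∈₁ with c′ , c′∈ , eq ← ∈-map⁻ (P₁ z ++_) c∈₁ = c′ , c′∈ , inj₁ eq
  ... | inj₂ c∈₂ with c′ , c′∈ , eq ← ∈-map⁻ (P₂ z ++_) c∈₂ = c′ , c′∈ , inj₂ eq

  mult-choice-≤ : (zs : List (List (Edge n))) {c : List (Edge n)} → c ∈ˡ choices zs →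
                  ∀ e → mult e c ≤ mult e (concat zs)
  mult-choice-≤ []       (here refl) e = z≤n
  mult-choice-≤ (z ∷ zs) {c} c∈ e with ∈-choices⁻ z zs c∈
  ... | c′ , c′∈ , inj₁ refl = begin
    mult e (P₁ z ++ c′)              ≡⟨ mult-++ e (P₁ z) c′ ⟩
    mult e (P₁ z) + mult e c′        ≤⟨ ℕ.+-mono-≤ (P₁-≤ e z) (mult-choice-≤ zs c′∈ e) ⟩
    mult e z + mult e (concat zs)    ≡⟨ mult-++ e z (concat zs) ⟨
    mult e (z ++ concat zs)          ∎
    where open ℕ.≤-Reasoning
  ... | c′ , c′∈ , inj₂ refl = begin
    mult e (P₂ z ++ c′)              ≡⟨ mult-++ e (P₂ z) c′ ⟩
    mult e (P₂ z) + mult e c′        ≤⟨ ℕ.+-mono-≤ (P₂-≤ e z) (mult-choice-≤ zs c′∈ e) ⟩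
    mult e z + mult e (concat zs)    ≡⟨ mult-++ e z (concat zs) ⟨
    mult e (z ++ concat zs)          ∎
    where open ℕ.≤-Reasoning

  mult-head : (x : Edge n) (xs : List (Edge n)) → 1 ≤ mult x (x ∷ xs)
  mult-head x xs = ℕ.≤-trans (ℕ.≤-reflexive (sym (⟦⟧-true (x ≟ x) refl))) (ℕ.m≤m+n _ _)

  NonEmpty : List A → Set _
  NonEmpty z = ∃₂ λ x xs → z ≡ x ∷ xs

  -- The head of z occurs in every choice through P₁ z and in none through P₂ z.
  choice-weights-≢ :
    (z : List (Edge n)) (zs : List (List (Edge n))) → NonEmpty z →
    (∀ e → mult e (concat (z ∷ zs)) ≤ 1) →
    ∀ {b c} → b ∈ˡ choices zs → c ∈ˡ choices zs → W₁ z + ∑ b w ≢ W₂ z + ∑ c w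
  choice-weights-≢ {n} z zs (x , xs , refl) ≤1 {b} {c} b∈ c∈ eq =
    ℕ.1+n≰n (begin
      2
        ≤⟨ ℕ.+-mono-≤ 1≤b 1≤c ⟩
      mult x (P₁ z) + mult x (P₂ z ++ c)
        ≡⟨ cong (mult x (P₁ z) +_) (mult-++ x (P₂ z) c) ⟩
      mult x (P₁ z) + (mult x (P₂ z) + mult x c)
        ≡⟨ ℕ.+-assoc (mult x (P₁ z)) _ _ ⟨
      mult x (P₁ z) + mult x (P₂ z) + mult x c
        ≡⟨ cong (_+ mult x c) (mult-P₁-P₂ x z) ⟨
      mult x z + mult x c
        ≤⟨ ℕ.+-monoʳ-≤ (mult x z) (mult-choice-≤ zs c∈ x) ⟩
      mult x z + mult x (concat zs)
        ≡⟨ mult-++ x z (concat zs) ⟨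
      mult x (concat (z ∷ zs))
        ≤⟨ ≤1 x ⟩
      1 ∎)
    where
    open ℕ.≤-Reasoning
    1≤b : 1 ≤ mult x (P₁ z)
    1≤b = subst (λ es → 1 ≤ mult x es) (sym (everyOther-∷ x xs))
      (mult-head x (everyOther (drop 1 xs)))
    b≤1 : ∀ e → mult e (P₁ z ++ b) ≤ 1
    b≤1 e = ℕ.≤-trans (mult-choice-≤ (z ∷ zs) (∈-++⁺ˡ (∈-map⁺ (P₁ z ++_) b∈)) e) (≤1 e)
    c≤1 : ∀ e → mult e (P₂ z ++ c) ≤ 1
    c≤1 e = ℕ.≤-trans (mult-choice-≤ (z ∷ zs) (∈-++⁺ʳ _ (∈-map⁺ (P₂ z ++_) c∈)) e) (≤1 e)
    -- Equal weights force equal multiplicities, so the head of `z` would also occur in the choice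
    -- through `P₂ z`.
    same : ∀ e → mult e (P₁ z ++ b) ≡ mult e (P₂ z ++ c)
    same = ∑-w-injective b≤1 c≤1 (trans (sym (∑-mult (P₁ z ++ b) w))
      (trans (∑-++ (P₁ z) b w) (trans eq (trans (sym (∑-++ (P₂ z) c w)) (∑-mult (P₂ z ++ c) w)))))
    1≤c : 1 ≤ mult x (P₂ z ++ c)
    1≤c = ℕ.≤-trans 1≤b (ℕ.≤-trans (ℕ.m≤m+n _ (mult x b))
      (ℕ.≤-reflexive (trans (sym (mult-++ x (P₁ z) b)) (same x))))

  -- No two terms of the product have the same exponent: choices that differ at the first cycle are
  -- separated by `choice-weights-≢`, the others by induction.
  ∑-choices-≤1 : (zs : List (List (Edge n))) → All NonEmpty zs →
                 (∀ e → mult e (concat zs) ≤ 1) →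
                 ∀ L → ∑ (choices zs) (λ c → ⟦ L ℕ.≟ ∑ c w ⟧) ≤ 1
  ∑-choices-≤1 [] _ _ L = ℕ.≤-trans (ℕ.≤-reflexive (ℕ.+-identityʳ _)) (⟦⟧≤1 (L ℕ.≟ 0))
  ∑-choices-≤1 (z ∷ zs) (z≢[] ∷ zs≢[]) ≤1 L =
    subst (_≤ 1) (sym (∑-choices z zs (λ k → ⟦ L ℕ.≟ k ⟧))) combined
    where
    tail≤1 : ∀ e → mult e (concat zs) ≤ 1
    tail≤1 e = ℕ.m+n≤o⇒n≤o (mult e z) (subst (_≤ 1) (mult-++ e z (concat zs)) (≤1 e))

    hits : ℕ → ℕ
    hits k = ∑ (choices zs) (λ c → ⟦ L ℕ.≟ k + ∑ c w ⟧)

    hit : ∀ k → hits k ≢ 0 → ∃ λ c → c ∈ˡ choices zs × L ≡ k + ∑ c w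
    hit k ≢0 with c , c∈ , ≢0′ ← ∑≢0 (choices zs) _ ≢0 =
      c , c∈ , ⟦⟧≢0 (L ℕ.≟ k + ∑ c w) ≢0′

    hits≤1 : ∀ k → hits k ≤ 1
    hits≤1 k with hits k ℕ.≟ 0
    ... | yes ≡0 = subst (_≤ 1) (sym ≡0) z≤n
    -- One hit `b` rewrites the target as `k + ∑ b w`; cancelling `k` leaves the induction
    -- hypothesis at target `∑ b w`.
    ... | no  ≢0 with b , _ , L≡ ← hit k ≢0 = subst (_≤ 1)
      (∑-cong (choices zs) λ c → ⟦⟧-⇔ (∑ b w ℕ.≟ ∑ c w) (L ℕ.≟ k + ∑ c w)
        (λ eq → trans L≡ (cong (k +_) eq)) (λ eq → ℕ.+-cancelˡ-≡ k _ _ (trans (sym L≡) eq)))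
      (∑-choices-≤1 zs zs≢[] tail≤1 (∑ b w))

    combined : hits (W₁ z) + hits (W₂ z) ≤ 1
    combined with hits (W₁ z) ℕ.≟ 0 | hits (W₂ z) ℕ.≟ 0
    ... | yes ≡0 | _ = subst (λ k → k + hits (W₂ z) ≤ 1) (sym ≡0) (hits≤1 (W₂ z))
    ... | no _ | yes ≡0 = subst (λ k → hits (W₁ z) + k ≤ 1) (sym ≡0)
                            (subst (_≤ 1) (sym (ℕ.+-identityʳ _)) (hits≤1 (W₁ z)))
    ... | no ≢0₁ | no ≢0₂ with b , b∈ , L≡₁ ← hit (W₁ z) ≢0₁ | c , c∈ , L≡₂ ← hit (W₂ z) ≢0₂ =
      contradiction (trans (sym L≡₁) L≡₂) (choice-weights-≢ z zs z≢[] ≤1 b∈ c∈)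

  -- Graphs alternating along the cycles

  weight : Graph n → ℕ
  weight {n} G = ∑ (edges n) λ e → ⟦ G e Bool.≟ true ⟧ * w e

  weight-cong : {G H : Graph n} → G ≗ H → weight G ≡ weight H
  weight-cong {n} G≗H = ∑-cong (edges n) λ e → cong (λ b → ⟦ b Bool.≟ true ⟧ * w e) (G≗H e)

  weight-injective : {G H : Graph n} → weight G ≡ weight H → G ≗ H
  weight-injective {n} {G} {H} eq e = bit-injective (G e) (H e)
    (∑-w-injective (λ f → ⟦⟧≤1 (G f Bool.≟ true)) (λ f → ⟦⟧≤1 (H f Bool.≟ true)) eq e)
    where
    bit-injective : ∀ b c → ⟦ b Bool.≟ true ⟧ ≡ ⟦ c Bool.≟ true ⟧ → b ≡ c
    bit-injective true  true  _ = refl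
    bit-injective false false _ = refl

  AlternatesOn : Graph n → List (Edge n) → Set
  AlternatesOn G = Linked (λ e f → G f ≡ not (G e))

  -- Passing to the next edge negates the value of `G` and exchanges the halves, hence the mutual
  -- recursion with `alternates-P₂`.
  alternates-P₁ : (G : Graph n) (x : Edge n) (xs : List (Edge n)) → AlternatesOn G (x ∷ xs) →
                  filter (λ e → G e Bool.≟ G x) (x ∷ xs) ≡ P₁ (x ∷ xs)
  alternates-P₂ : (G : Graph n) (x : Edge n) (xs : List (Edge n)) → AlternatesOn G (x ∷ xs) →
                  filter (λ e → G e Bool.≟ not (G x)) (x ∷ xs) ≡ P₂ (x ∷ xs)

  alternates-P₁ G x xs alt = trans (filter-accept (λ e → G e Bool.≟ G x) refl)
    (trans (cong (x ∷_) (tail xs alt)) (sym (everyOther-∷ x xs)))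
    where
    tail : ∀ xs → AlternatesOn G (x ∷ xs) →
           filter (λ e → G e Bool.≟ G x) xs ≡ everyOther (drop 1 xs)
    tail []       _            = refl
    tail (y ∷ ys) (Gy≡ ∷ alt) = trans
      (cong (λ t → filter (λ e → G e Bool.≟ t) (y ∷ ys))
        (trans (sym (Bool.not-involutive (G x))) (cong not (sym Gy≡))))
      (alternates-P₂ G y ys alt)

  alternates-P₂ G x xs alt = trans
    (filter-reject (λ e → G e Bool.≟ not (G x)) (Bool.not-¬ refl)) (tail xs alt)
    where
    tail : ∀ xs → AlternatesOn G (x ∷ xs) →
           filter (λ e → G e Bool.≟ not (G x)) xs ≡ everyOther xs
    tail []       _            = refl
    tail (y ∷ ys) (Gy≡ ∷ alt) = trans
      (cong (λ t → filter (λ e → G e Bool.≟ t) (y ∷ ys)) (sym Gy≡))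
      (alternates-P₁ G y ys alt)

  alternates-choice : (G : Graph n) (z : List (Edge n)) → NonEmpty z → AlternatesOn G z →
    filter (λ e → G e Bool.≟ true) z ≡ P₁ z ⊎ filter (λ e → G e Bool.≟ true) z ≡ P₂ z
  alternates-choice G z (x , xs , refl) alt = byHead (G x) refl
    where
    byHead : ∀ t → G x ≡ t → filter (λ e → G e Bool.≟ true) z ≡ P₁ z ⊎
                              filter (λ e → G e Bool.≟ true) z ≡ P₂ z
    byHead true  Gx = inj₁ (trans (cong (λ t → filter (λ e → G e Bool.≟ t) z) (sym Gx))
                                   (alternates-P₁ G x xs alt))
    byHead false Gx = inj₂ (trans (cong (λ t → filter (λ e → G e Bool.≟ not t) z) (sym Gx))
                                   (alternates-P₂ G x xs alt))

  filter∈choices : (G : Graph n) (zs : List (List (Edge n))) → All NonEmpty zs →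
                   All (AlternatesOn G) zs →
                   filter (λ e → G e Bool.≟ true) (concat zs) ∈ˡ choices zs
  filter∈choices G []       _               _            = here refl
  filter∈choices G (z ∷ zs) (z≢[] ∷ zs≢[]) (alt ∷ alts) =
    subst (_∈ˡ choices (z ∷ zs)) (sym (filter-++ (λ e → G e Bool.≟ true) z (concat zs)))
      ([ (λ eq → subst (λ es → es ++ c ∈ˡ choices (z ∷ zs)) (sym eq)
           (∈-++⁺ˡ (∈-map⁺ (P₁ z ++_) c∈)))
       , (λ eq → subst (λ es → es ++ c ∈ˡ choices (z ∷ zs)) (sym eq)
           (∈-++⁺ʳ _ (∈-map⁺ (P₂ z ++_) c∈)))
       ]′ (alternates-choice G z z≢[] alt))
    where
    c = filter (λ e → G e Bool.≟ true) (concat zs)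
    c∈ = filter∈choices G zs zs≢[] alts

  mult-filter-≟ : (G : Graph n) (t : Bool) (e : Edge n) (es : List (Edge n)) →
                  mult e (filter (λ f → G f Bool.≟ t) es) ≡ ⟦ G e Bool.≟ t ⟧ * mult e es
  mult-filter-≟ G t e es = begin
    mult e (filter (λ f → G f Bool.≟ t) es)
      ≡⟨ ∑-filter (λ f → G f Bool.≟ t) es _ ⟩
    ∑ es (λ f → ⟦ G f Bool.≟ t ⟧ * ⟦ e ≟ f ⟧)
      ≡⟨ ∑-cong es (λ f → ℕ.*-comm ⟦ G f Bool.≟ t ⟧ _) ⟩
    ∑ es (λ f → ⟦ e ≟ f ⟧ * ⟦ G f Bool.≟ t ⟧)
      ≡⟨ ∑-pick e es (λ { refl → refl }) ⟩
    mult e es * ⟦ G e Bool.≟ t ⟧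
      ≡⟨ ℕ.*-comm (mult e es) _ ⟩
    ⟦ G e Bool.≟ t ⟧ * mult e es ∎
    where open ≡-Reasoning

  weight-filter : (G : Graph n) (es : List (Edge n)) → (∀ e → mult e es ≡ 1) →
                  ∑ (filter (λ e → G e Bool.≟ true) es) w ≡ weight G
  weight-filter {n} G es once = trans (∑-mult (filter (λ e → G e Bool.≟ true) es) w)
    (∑-cong (edges n) λ e → cong (_* w e) (trans (mult-filter-≟ G true e es)
      (trans (cong (⟦ G e Bool.≟ true ⟧ *_) (once e)) (ℕ.*-identityʳ ⟦ G e Bool.≟ true ⟧))))

  P₁-or-P₂-filter : (G : Graph n) (z es : List (Edge n)) → NonEmpty z → AlternatesOn G z →
                    es ≡ P₁ z ⊎ es ≡ P₂ z → ∃ λ t → es ≡ filter (λ e → G e Bool.≟ t) z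
  P₁-or-P₂-filter G _ _ (x , xs , refl) alt (inj₁ eq) =
    G x , trans eq (sym (alternates-P₁ G x xs alt))
  P₁-or-P₂-filter G _ _ (x , xs , refl) alt (inj₂ eq) =
    not (G x) , trans eq (sym (alternates-P₂ G x xs alt))

  mult≥1 : {e : Edge n} {es : List (Edge n)} → e ∈ˡ es → 1 ≤ mult e es
  mult≥1 e∈es = ℕ.n≢0⇒n>0 (Any⇒mult≢0 e∈es)

  -- Each half of a cycle is a level set of the reference graph `G`. The level `t` depends on the
  -- cycle but not on the edge, so that `c` follows `G` or its complement along all of `z`.
  choice-on-cycle :
    (G : Graph n) (zs : List (List (Edge n))) → All NonEmpty zs → All (AlternatesOn G) zs →
    (∀ e → mult e (concat zs) ≤ 1) → ∀ {c} → c ∈ˡ choices zs → ∀ {z} → z ∈ˡ zs →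
    ∃ λ t → ∀ {e} → e ∈ˡ z → mult e c ≡ ⟦ G e Bool.≟ t ⟧
  choice-on-cycle {n} G (z₀ ∷ zs) (z₀≢[] ∷ zs≢[]) (alt ∷ alts) ≤1 {c} c∈ {z} z∈
    with ∈-choices⁻ z₀ zs c∈
  ... | c′ , c′∈ , c≡ = split z∈
    where
    split≤1 : ∀ e → mult e z₀ + mult e (concat zs) ≤ 1
    split≤1 e = subst (_≤ 1) (mult-++ e z₀ (concat zs)) (≤1 e)

    filtered : c ≡ P₁ z₀ ++ c′ ⊎ c ≡ P₂ z₀ ++ c′ →
               ∃ λ t → c ≡ filter (λ e → G e Bool.≟ t) z₀ ++ c′
    filtered (inj₁ eq) with t , P₁≡ ← P₁-or-P₂-filter G z₀ (P₁ z₀) z₀≢[] alt (inj₁ refl) =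
      t , trans eq (cong (_++ c′) P₁≡)
    filtered (inj₂ eq) with t , P₂≡ ← P₁-or-P₂-filter G z₀ (P₂ z₀) z₀≢[] alt (inj₂ refl) =
      t , trans eq (cong (_++ c′) P₂≡)

    t₀ = proj₁ (filtered c≡)

    mult-c : ∀ e → mult e c ≡ ⟦ G e Bool.≟ t₀ ⟧ * mult e z₀ + mult e c′
    mult-c e = trans (cong (mult e) (proj₂ (filtered c≡)))
      (trans (mult-++ e (filter (λ f → G f Bool.≟ t₀) z₀) c′)
             (cong (_+ mult e c′) (mult-filter-≟ G t₀ e z₀)))

    split : z ∈ˡ z₀ ∷ zs → ∃ λ t → ∀ {e} → e ∈ˡ z → mult e c ≡ ⟦ G e Bool.≟ t ⟧
    split (here refl) = t₀ , λ {e} e∈z → begin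
      mult e c
        ≡⟨ mult-c e ⟩
      ⟦ G e Bool.≟ t₀ ⟧ * mult e z₀ + mult e c′
        -- An edge of `z₀` occurs there once and in no later cycle, hence not in `c′`.
        ≡⟨ cong₂ (λ k l → ⟦ G e Bool.≟ t₀ ⟧ * k + l)
             (ℕ.≤-antisym (ℕ.m+n≤o⇒m≤o _ (split≤1 e)) (mult≥1 e∈z))
             (ℕ.n≤0⇒n≡0 (ℕ.≤-trans (mult-choice-≤ zs c′∈ e)
               (ℕ.+-cancelˡ-≤ 1 _ _ (ℕ.≤-trans (ℕ.+-monoˡ-≤ _ (mult≥1 e∈z)) (split≤1 e))))) ⟩
      ⟦ G e Bool.≟ t₀ ⟧ * 1 + 0
        ≡⟨ trans (ℕ.+-identityʳ _) (ℕ.*-identityʳ _) ⟩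
      ⟦ G e Bool.≟ t₀ ⟧ ∎
      where open ≡-Reasoning
    split (there z∈zs)
      with t , mult-c′ ← choice-on-cycle G zs zs≢[] alts
                           (λ e → ℕ.m+n≤o⇒n≤o (mult e z₀) (split≤1 e)) c′∈ z∈zs
      = t , λ {e} e∈z → begin
      mult e c
        ≡⟨ mult-c e ⟩
      ⟦ G e Bool.≟ t₀ ⟧ * mult e z₀ + mult e c′
        -- An edge of a later cycle does not occur in `z₀`.
        ≡⟨ cong₂ (λ k l → ⟦ G e Bool.≟ t₀ ⟧ * k + l)
             (ℕ.n≤0⇒n≡0 (ℕ.+-cancelʳ-≤ 1 _ _ (ℕ.≤-trans
               (ℕ.+-monoʳ-≤ (mult e z₀) (mult≥1 (∈-concat⁺′ e∈z z∈zs))) (split≤1 e))))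
             (mult-c′ e∈z) ⟩
      ⟦ G e Bool.≟ t₀ ⟧ * 0 + ⟦ G e Bool.≟ t ⟧
        ≡⟨ cong (_+ ⟦ G e Bool.≟ t ⟧) (ℕ.*-zeroʳ ⟦ G e Bool.≟ t₀ ⟧) ⟩
      ⟦ G e Bool.≟ t ⟧ ∎
      where open ≡-Reasoning

  w-injective : (e f : Edge n) → w e ≡ w f → e ≡ f
  w-injective e f eq with ℕ.<-cmp (exponent e) (exponent f)
  ... | tri< lt _ _ = contradiction eq (ℕ.<⇒≢ (ℕ.^-monoʳ-< 2 (s≤s (s≤s z≤n)) lt))
  ... | tri≈ _ eq′ _ = exponent-injective e f eq′
  ... | tri> _ _ gt = contradiction (sym eq) (ℕ.<⇒≢ (ℕ.^-monoʳ-< 2 (s≤s (s≤s z≤n)) gt))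

  -- The cycles of a fixed permutation and the coefficients of its polynomial

  module Cycles {n} (α : Permutation′ n) where

    open Orbits _≟_ (edges n) ∈-edges (α ′) (′-injective α) public

    -- `cycleFrom α` unfolds to `orbit`, and the filter in `Z` to `leading? w`, so this is
    -- `leading-orbit` for the injective function `w`.
    mult-Z : (e : Edge n) → mult e (concat (Z α)) ≡ 1
    mult-Z e = begin
      mult e (concat (Z α))
        ≡⟨ ∑-concat (Z α) _ ⟩
      ∑ (Z α) (mult e)
        ≡⟨ ∑-map (cycleFrom α) (filter (leading? w) (edges n)) (mult e) ⟩
      ∑ (filter (leading? w) (edges n)) (λ f → mult e (cycleFrom α f))
        ≡⟨ ∑-filter (leading? w) (edges n) _ ⟩
      ∑ (edges n) (λ f → ⟦ leading? w f ⟧ * mult e (cycleFrom α f))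
        ≡⟨ leading-orbit w (λ {f} {g} → w-injective f g) mult-edges e ⟩
      1 ∎
      where open ≡-Reasoning

    mult-Z-≤1 : (e : Edge n) → mult e (concat (Z α)) ≤ 1
    mult-Z-≤1 e = ℕ.≤-reflexive (mult-Z e)

    Z-NonEmpty : All NonEmpty (Z α)
    Z-NonEmpty = All.map⁺ (All.universal (λ e → _ , _ , refl) (filter (leading? w) (edges n)))

    Z-closed : ∀ {z e} → z ∈ˡ Z α → e ∈ˡ z → (α ′) e ∈ˡ z
    Z-closed {e = e} z∈Z e∈z =
      let f , _ , z≡ = ∈-map⁻ (cycleFrom α) z∈Z
      in subst ((α ′) e ∈ˡ_) (sym z≡) (orbit-closed f (subst (e ∈ˡ_) z≡ e∈z))

    Alternating : Graph n → Set
    Alternating G = ∀ e → G ((α ′) e) ≡ not (G e)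

    anti⇒alternating : {G : Graph n} → α · G ≗ complement G → Alternating G
    anti⇒alternating {G} αG≗Ḡ e = begin
      G ((α ′) e)              ≡⟨ Bool.not-involutive (G ((α ′) e)) ⟨
      not (not (G ((α ′) e)))  ≡⟨ cong not (αG≗Ḡ ((α ′) e)) ⟨
      not ((α · G) ((α ′) e))  ≡⟨ cong not (·-apply α G e) ⟩
      not (G e)                ∎
      where open ≡-Reasoning

    alternating⇒anti : {G : Graph n} → Alternating G → α · G ≗ complement G
    alternating⇒anti {G} alt e = begin
      (α · G) e                ≡⟨ cong (α · G) (′-inverseʳ α e) ⟨
      (α · G) ((α ′) f)        ≡⟨ ·-apply α G f ⟩
      G f                      ≡⟨ Bool.not-involutive (G f) ⟨
      not (not (G f))          ≡⟨ cong not (alt f) ⟨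
      not (G ((α ′) f))        ≡⟨ cong (not ∘ G) (′-inverseʳ α e) ⟩
      not (G e)                ∎
      where
      open ≡-Reasoning
      f = (flip α ′) e

    alternates-Z : (G : Graph n) → Alternating G → All (AlternatesOn G) (Z α)
    alternates-Z G alt = All.map⁺ (All.universal
      (λ e → Linked.map (λ {x} y≡αx → trans (cong G y≡αx) (alt x)) (orbit-linked e))
      (filter (leading? w) (edges n)))

    choiceGraph : List (Edge n) → Graph n
    choiceGraph c e = does (mult e c ℕ.≟ 1)

    module _ (G : Graph n) (alt : Alternating G) {c} (c∈ : c ∈ˡ choices (Z α)) where

      -- On the cycle through `e`, which also contains its image, the choice is a level set of `G`,
      -- and `G` changes value between the two edges. This covers the closing step of the cycle as
      -- well.
      choiceGraph-alternating : Alternating (choiceGraph c)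
      choiceGraph-alternating e =
        let z , e∈z , z∈Z = ∈-concat⁻′ (Z α) (mult≢0⇒Any (concat (Z α))
                              λ eq → ℕ.1+n≢0 (trans (sym (mult-Z e)) eq))
            t , mult-c    = choice-on-cycle G (Z α) Z-NonEmpty (alternates-Z G alt) mult-Z-≤1 c∈ z∈Z
        in begin
          does (mult ((α ′) e) c ℕ.≟ 1)
            ≡⟨ cong (λ k → does (k ℕ.≟ 1)) (mult-c (Z-closed z∈Z e∈z)) ⟩
          does (⟦ G ((α ′) e) Bool.≟ t ⟧ ℕ.≟ 1)
            ≡⟨ cong (λ b → does (⟦ b Bool.≟ t ⟧ ℕ.≟ 1)) (alt e) ⟩
          does (⟦ not (G e) Bool.≟ t ⟧ ℕ.≟ 1)
            ≡⟨ flipped (G e) t ⟩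
          not (does (⟦ G e Bool.≟ t ⟧ ℕ.≟ 1))
            ≡⟨ cong (λ k → not (does (k ℕ.≟ 1))) (mult-c e∈z) ⟨
          not (does (mult e c ℕ.≟ 1)) ∎
        where
        open ≡-Reasoning
        flipped : ∀ b t → does (⟦ not b Bool.≟ t ⟧ ℕ.≟ 1) ≡ not (does (⟦ b Bool.≟ t ⟧ ℕ.≟ 1))
        flipped true  true  = refl
        flipped true  false = refl
        flipped false true  = refl
        flipped false false = refl

      weight-choiceGraph : weight (choiceGraph c) ≡ ∑ c w
      weight-choiceGraph = sym (trans (∑-mult c w) (∑-cong (edges n) λ e →
        cong (_* w e) (bit (mult e c)
          (ℕ.≤-trans (mult-choice-≤ (Z α) c∈ e) (mult-Z-≤1 e)))))
        where
        bit : ∀ k → k ≤ 1 → k ≡ ⟦ does (k ℕ.≟ 1) Bool.≟ true ⟧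
        bit 0 _ = refl
        bit 1 _ = refl
        bit (suc (suc _)) (s≤s ())

    -- `G` is the reference graph; `H` is read off from a term of the product with exponent `L`, and
    -- may differ from `G`.
    coeff-Uα≢0 : (G : Graph n) → α · G ≗ complement G → ∀ L → coeff (Uα α) L ≢ 0 →
                 ∃ λ H → α · H ≗ complement H × L ≡ weight H
    coeff-Uα≢0 G αG≗Ḡ L ≢0 =
      let alt = anti⇒alternating {G} αG≗Ḡ
          c , c∈ , hit = ∑≢0 (choices (Z α)) (λ c → ⟦ L ℕ.≟ ∑ c w ⟧) (≢0 ∘ trans (coeff-Πₚ (Z α) L))
      in choiceGraph c
       , alternating⇒anti {choiceGraph c} (choiceGraph-alternating G alt c∈)
       , trans (⟦⟧≢0 (L ℕ.≟ ∑ c w) hit) (sym (weight-choiceGraph G alt c∈))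

    -- The edges of `G`, listed cycle by cycle, are one of the choices, and no other choice has the
    -- same weight.
    coeff-Uα-weight : (G : Graph n) → α · G ≗ complement G → coeff (Uα α) (weight G) ≡ 1
    coeff-Uα-weight G αG≗Ḡ = trans (coeff-Πₚ (Z α) (weight G)) (ℕ.≤-antisym
      (∑-choices-≤1 (Z α) Z-NonEmpty mult-Z-≤1 (weight G))
      (∑≥1 (choices (Z α)) _ (filter∈choices G (Z α) Z-NonEmpty
          (alternates-Z G (anti⇒alternating {G} αG≗Ḡ)))
        (⟦⟧-true (weight G ℕ.≟ _) (sym (weight-filter G (concat (Z α)) mult-Z)))))
      where
      ∑≥1 : ∀ {a} {A : Set a} (xs : List A) (f : A → ℕ) {x} → x ∈ˡ xs → f x ≡ 1 → 1 ≤ ∑ xs f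
      ∑≥1 (x ∷ xs) f (here refl) eq = ℕ.≤-trans (ℕ.≤-reflexive (sym eq)) (ℕ.m≤m+n _ _)
      ∑≥1 (x ∷ xs) f (there x∈)  eq = ℕ.≤-trans (∑≥1 xs f x∈ eq) (ℕ.m≤n+m _ _)

    -- The first bracket extends the sum defining `U n` from `Aₛ` to all permutations. A graph
    -- carried to its complement by `α` is itself the witness for `Aₛ α`.
    coeff-Uα : (G : Graph n) → (α∈? : Dec (Aₛ α)) (anti? : Dec (α · G ≗ complement G)) →
               ⟦ α∈? ⟧ * coeff (Uα α) (weight G) ≡ ⟦ anti? ⟧
    coeff-Uα G (no α∉)  (yes αG≗Ḡ) = contradiction (G , (α , αG≗Ḡ) , αG≗Ḡ) α∉
    coeff-Uα G (no α∉)  (no _)     = refl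
    coeff-Uα G (yes _)  (yes αG≗Ḡ) = trans (ℕ.*-identityˡ _) (coeff-Uα-weight G αG≗Ḡ)
    coeff-Uα G (yes (G₀ , _ , αG₀≗)) (no αG≇Ḡ) = trans (ℕ.*-identityˡ _)
      -- A nonzero coefficient would come from a graph `H` carried to its complement by `α` and
      -- having the weight of `G`, so `H` would be `G`.
      (zero? (coeff (Uα α) (weight G) ℕ.≟ 0))
      where
      zero? : Dec (coeff (Uα α) (weight G) ≡ 0) → coeff (Uα α) (weight G) ≡ 0
      zero? (yes ≡0) = ≡0
      zero? (no ≢0) =
        let H , αH≗H̄ , eq = coeff-Uα≢0 G₀ αG₀≗ (weight G) ≢0
            G≗H = weight-injective {G = G} {H} eq
        in contradiction
          (λ e → trans (·-cong α {G} {H} G≗H e) (trans (αH≗H̄ e) (cong not (sym (G≗H e))))) αG≇Ḡ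

  -- The coefficients of the whole polynomial

  d-∑ : (n L : ℕ) → d n L ≡ ∑ (permutations n) (λ α → ⟦ Aₛ? α ⟧ * coeff (Uα α) L)
  d-∑ n L = trans (coeff-Σₚ (filter Aₛ? (permutations n)) Uα L)
                  (∑-filter Aₛ? (permutations n) (λ α → coeff (Uα α) L))

  d-weight : (G : Graph n) → d n (weight G) ≡ transporters G (complement G)
  d-weight {n} G = trans (d-∑ n (weight G)) (∑-cong (permutations n) λ α →
    Cycles.coeff-Uα α G (Aₛ? α) ((α · G) ≗? complement G))

  d≢0⇒weight : ∀ n L → d n L ≢ 0 → ∃ λ (G : Graph n) → SelfComplementary G × L ≡ weight G
  d≢0⇒weight n L ≢0 =
    let α , _ , term≢0 = ∑≢0 (permutations n)
          (λ α → ⟦ Aₛ? α ⟧ * coeff (Uα α) L) (≢0 ∘ trans (d-∑ n L))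
        G , _ , αG≗Ḡ   = ⟦⟧≢0 (Aₛ? α) (λ eq → term≢0 (cong (_* coeff (Uα α) L) eq))
        H , αH≗H̄ , L≡  = Cycles.coeff-Uα≢0 α G αG≗Ḡ L
          (λ eq → term≢0 (trans (cong (⟦ Aₛ? α ⟧ *_) eq) (ℕ.*-zeroʳ ⟦ Aₛ? α ⟧)))
    in H , (α , αH≗H̄) , L≡

  -- Counting labelled and unlabelled graphs

  module Naturals = Multiplicity ℕ.≡-decSetoid

  ≗⇒isomorphic : {G H : Graph n} → G ≗ H → Isomorphic G H
  ≗⇒isomorphic {G = G} G≗H = Perm.id , λ e →
    trans (sym (G≗H e)) (proj₂ (Isomorphic-refl {G = G}) e)

  self-complementary⇒isomorphic : {G : Graph n} → SelfComplementary G →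
                                  Isomorphic G (complement G)
  self-complementary⇒isomorphic (α , αG≗Ḡ) = α , ≗-sym αG≗Ḡ

  isomorphic⇒self-complementary : {G : Graph n} → Isomorphic G (complement G) →
                                  SelfComplementary G
  isomorphic⇒self-complementary (α , Ḡ≗αG) = α , ≗-sym Ḡ≗αG

  isomorphic-self-complementary : {G H : Graph n} → Isomorphic G H →
                                  SelfComplementary G → SelfComplementary H
  isomorphic-self-complementary {G = G} {H} G≅H@(α , H≗αG) sc =
    isomorphic⇒self-complementary {G = H}
      (Isomorphic-trans {G = H} {complement G} {complement H}
        (Isomorphic-trans {G = H} {G} {complement G}
          (Isomorphic-sym {G = G} {H} G≅H)
          (self-complementary⇒isomorphic {G = G} sc))
        (α , λ e → trans (cong not (H≗αG e)) (sym (·-complement α G e))))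

  module Counting (n ξ : ℕ) where

    -- The cardinality condition on `Γ G` in decidable form; `Γ-cardinality` and
    -- `cardinality-unique` translate between the two.
    Counted : Graph n → Set
    Counted G = SelfComplementary G × transporters G G ≡ ξ

    Counted? : Decidable Counted
    Counted? G =
      map′ (isomorphic⇒self-complementary {G = G}) (self-complementary⇒isomorphic {G = G})
           (Isomorphic? G (complement G))
      ×-dec (transporters G G ℕ.≟ ξ)

    isomorphic-counted : {G H : Graph n} → Isomorphic G H → Counted G → Counted H
    isomorphic-counted {G} {H} G≅H (sc , eq) =
        isomorphic-self-complementary {G = G} {H} G≅H sc
      , trans (transporters-stabiliser {G = G} {H} G≅H) eq

    labelled : List (Graph n)
    labelled = filter Counted? (graphs n)

    labelled-counted : All Counted labelled
    labelled-counted = All.all-filter Counted? (graphs n)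

    mult-labelled : (G : Graph n) → Counted G → Graphs.mult G labelled ≡ 1
    mult-labelled G counted = trans
      (Graphs.mult-filter Counted? {y = G} (graphs n)
        λ {H} G≗H → isomorphic-counted {G} {H} (≗⇒isomorphic {G = G} {H} G≗H) counted)
      (mult-graphs G)

    unlabelled : List (Graph n)
    unlabelled = IsomorphismClasses.nub labelled

    unlabelled-counted : All Counted unlabelled
    unlabelled-counted = IsomorphismClasses.nub-All labelled-counted

    mult-unlabelled : (G : Graph n) → Counted G →
                      IsomorphismClasses.mult G unlabelled ≡ 1
    mult-unlabelled G counted = IsomorphismClasses.mult-nub {y = G} labelled
      (Any.map (λ {H} → ≗⇒isomorphic {G = G} {H}) (Graphs.mult≢0⇒Any {y = G} labelled
        λ eq → ℕ.1+n≢0 (trans (sym (mult-labelled G counted)) eq)))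

    -- Double counting of the triples of a representative `G`, a permutation `α` and a labelled `H`
    -- with `α · G ≗ H`. Each `G` lies in `n !` of them, one for every `α`; each `H` lies in `ξ`,
    -- since it has one representative and `ξ` permutations carry that to `H`.
    orbit-count : length unlabelled * n ! ≡ length labelled * ξ
    orbit-count = begin
      length unlabelled * n !
        ≡⟨ ∑-const unlabelled (n !) ⟨
      ∑ unlabelled (λ G → n !)
        ≡⟨ ∑-cong-∈ unlabelled (λ {G} G∈ → begin
             n !
               ≡⟨ length-permutations n ⟨
             length (permutations n)
               ≡⟨ length-∑ (permutations n) ⟩
             ∑ (permutations n) (λ _ → 1)
               ≡⟨ ∑-cong (permutations n) (λ α → sym
                    (mult-labelled (α · G) (isomorphic-counted {G} (α , λ _ → refl)
                      (All.lookup unlabelled-counted G∈)))) ⟩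
             ∑ (permutations n) (λ α → ∑ labelled (λ H → ⟦ (α · G) ≗? H ⟧))
               ≡⟨ ∑-swap (permutations n) labelled (λ α H → ⟦ (α · G) ≗? H ⟧) ⟩
             ∑ labelled (λ H → transporters G H)
               ≡⟨ ∑-cong labelled (λ H →
                    transporters-counted {G} {H}
                      (All.lookup unlabelled-counted G∈) (Isomorphic? H G)) ⟩
             ∑ labelled (λ H → ⟦ Isomorphic? H G ⟧ * ξ) ∎) ⟩
      ∑ unlabelled (λ G → ∑ labelled (λ H → ⟦ Isomorphic? H G ⟧ * ξ))
        ≡⟨ ∑-swap unlabelled labelled (λ G H → ⟦ Isomorphic? H G ⟧ * ξ) ⟩
      ∑ labelled (λ H → ∑ unlabelled (λ G → ⟦ Isomorphic? H G ⟧ * ξ))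
        ≡⟨ ∑-cong-∈ labelled (λ {H} H∈ → begin
             ∑ unlabelled (λ G → ⟦ Isomorphic? H G ⟧ * ξ)
               ≡⟨ ∑-*ʳ unlabelled _ ξ ⟩
             IsomorphismClasses.mult H unlabelled * ξ
               ≡⟨ cong (_* ξ) (mult-unlabelled H (All.lookup labelled-counted H∈)) ⟩
             1 * ξ
               ≡⟨ ℕ.*-identityˡ ξ ⟩
             ξ ∎) ⟩
      ∑ labelled (λ H → ξ)
        ≡⟨ ∑-const labelled ξ ⟩
      length labelled * ξ ∎
      where
      open ≡-Reasoning
      transporters-counted : {G H : Graph n} → Counted G → (H≅G? : Dec (Isomorphic H G)) →
                             transporters G H ≡ ⟦ H≅G? ⟧ * ξ
      transporters-counted {G} {H} (_ , eq) (yes H≅G) = trans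
        (transporters-isomorphic {G = G} {H} (Isomorphic-sym {G = H} {G} H≅G))
        (trans eq (sym (ℕ.*-identityˡ ξ)))
      transporters-counted {G} {H} _ (no H≇G) = trans
        (∑-cong (permutations n) λ α → ⟦⟧-false ((α · G) ≗? H) λ αG≗H →
          H≇G (Isomorphic-sym {G = G} {H} (α , ≗-sym αG≗H)))
        (trans (∑-const (permutations n) 0) (ℕ.*-zeroʳ (length (permutations n))))

    UnlabelledSC-cardinality : UnlabelledSC n ξ HasCardinality length unlabelled
    UnlabelledSC-cardinality = IsomorphismClasses.cardinality unlabelled
      (All.map (λ {G} (sc , eq) → sc , subst (Γ G HasCardinality_) eq (Γ-cardinality G))
        unlabelled-counted)
      λ G (sc , Γ≅ξ) → mult-unlabelled G (sc , cardinality-unique (Γ-cardinality G) Γ≅ξ)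

    -- A nonzero coefficient occurs only at the weight of a self-complementary graph, so `weight` is
    -- a bijection from the labelled graphs counted. For `ξ` equal to 0 the set of exponents would
    -- be infinite.
    𝓛-cardinality : ξ ≢ 0 → 𝓛 ξ n HasCardinality length labelled
    𝓛-cardinality ξ≢0 =
      subst (𝓛 ξ n HasCardinality_) (length-map weight labelled)
        (Naturals.cardinality (map weight labelled)
          (All.map⁺ (All.map (λ {G} (sc , eq) → trans (d-self-complementary G sc) eq)
            labelled-counted))
          once)
      where
      open ≡-Reasoning
      d-self-complementary : ∀ G → SelfComplementary G → d n (weight G) ≡ transporters G G
      d-self-complementary G sc =
        trans (d-weight G)
          (transporters-isomorphic {G = G} {complement G} (self-complementary⇒isomorphic {G = G} sc))

      once : ∀ L → d n L ≡ ξ → Naturals.mult L (map weight labelled) ≡ 1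
      once L dL≡ξ =
        let G , sc , L≡ = d≢0⇒weight n L (λ dL≡0 → ξ≢0 (trans (sym dL≡ξ) dL≡0)) in begin
        Naturals.mult L (map weight labelled)
          ≡⟨ ∑-map weight labelled _ ⟩
        ∑ labelled (λ H → ⟦ L ℕ.≟ weight H ⟧)
          ≡⟨ ∑-cong labelled (λ H → ⟦⟧-⇔ (L ℕ.≟ weight H) (G ≗? H)
               (λ eq → weight-injective {G = G} {H} (trans (sym L≡) eq))
               (λ G≗H → trans L≡ (weight-cong {G = G} {H} G≗H))) ⟩
        Graphs.mult G labelled
          ≡⟨ mult-labelled G
               (sc , trans (sym (d-self-complementary G sc)) (trans (cong (d n) (sym L≡)) dL≡ξ)) ⟩
        1 ∎

  -- The fractions in the statement are reduced to lowest terms; between unreduced fractions the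
  -- equation is mere cross-multiplication.
  s≡ξ/n!*ℓ : (s ξ ℓ m : ℕ) .{{_ : NonZero m}} → s * m ≡ ℓ * ξ →
              ℤ.+ s ℚ./ 1 ≡ (ℤ.+ ξ ℚ./ m) ℚ.* (ℤ.+ ℓ ℚ./ 1)
  s≡ξ/n!*ℓ s ξ ℓ (suc m) eq = ℚ.toℚᵘ-injective (begin
    ℚ.toℚᵘ (ℤ.+ s ℚ./ 1)
      ≈⟨ ℚ.toℚᵘ-fromℚᵘ (ℚᵘ.mkℚᵘ (ℤ.+ s) 0) ⟩
    ℚᵘ.mkℚᵘ (ℤ.+ s) 0
      ≈⟨ ℚᵘ.*≡* cross ⟩
    -- `mkℚᵘ` takes the denominator minus one: `m` stands for `suc m`, and 0 for 1.
    ℚᵘ.mkℚᵘ (ℤ.+ ξ) m ℚᵘ.* ℚᵘ.mkℚᵘ (ℤ.+ ℓ) 0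
      ≈⟨ ℚᵘ.*-cong (ℚ.toℚᵘ-fromℚᵘ (ℚᵘ.mkℚᵘ (ℤ.+ ξ) m)) (ℚ.toℚᵘ-fromℚᵘ (ℚᵘ.mkℚᵘ (ℤ.+ ℓ) 0)) ⟨
    ℚ.toℚᵘ (ℤ.+ ξ ℚ./ suc m) ℚᵘ.* ℚ.toℚᵘ (ℤ.+ ℓ ℚ./ 1)
      ≈⟨ ℚ.toℚᵘ-homo-* (ℤ.+ ξ ℚ./ suc m) (ℤ.+ ℓ ℚ./ 1) ⟨
    ℚ.toℚᵘ ((ℤ.+ ξ ℚ./ suc m) ℚ.* (ℤ.+ ℓ ℚ./ 1)) ∎)
    where
    open ℚᵘ.≃-Reasoning
    cross : ℤ.+ s ℤ.* ℤ.+ (suc m * 1) ≡ ℤ.+ ξ ℤ.* ℤ.+ ℓ ℤ.* ℤ.+ 1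
    cross = trans (sym (ℤ.pos-* s (suc m * 1)))
        (trans (cong ℤ.+_ (trans (cong (s *_) (ℕ.*-identityʳ (suc m))) (trans eq (ℕ.*-comm ℓ ξ))))
          (trans (ℤ.pos-* ξ ℓ) (sym (ℤ.*-identityʳ (ℤ.+ ξ ℤ.* ℤ.+ ℓ)))))

open Development using (module Counting; s≡ξ/n!*ℓ)
open import Data.Integer.Base using (+_)
open import Data.Nat.Base using (ℕ; _≥_; _!)
open import Data.Nat.DivMod using (_%_)
open import Data.Nat.Properties using (_!≢0)
open import Data.List.Base using (length)
open import Data.Product.Base using (∃₂; _×_; _,_)
open import Data.Rational.Base using (_/_; _*_)
open import Data.Sum.Base using (_⊎_)
open import Relation.Binary.PropositionalEquality using (_≡_; sym; trans)
open import Relation.Unary using (_∈_)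

theorem12 : (n : ℕ) → n ≥ 4 → n % 4 ≡ 0 ⊎ n % 4 ≡ 1 →
    (ξ : ℕ) → ξ ∈ 𝒟 n →
    ∃₂ λ (s ℓ : ℕ) →
    UnlabelledSC n ξ HasCardinality s ×
    𝓛 ξ n HasCardinality ℓ ×
    (+ s / 1 ≡ _/_ (+ ξ) (n !) {{ n !≢0 }} * (+ ℓ / 1))
theorem12 n _ _ ξ (_ , dL≢0 , ξ≡dL) =
    length unlabelled
  , length labelled
  , UnlabelledSC-cardinality
  , 𝓛-cardinality (λ ξ≡0 → dL≢0 (trans (sym ξ≡dL) ξ≡0))
  , s≡ξ/n!*ℓ (length unlabelled) ξ (length labelled) (n !) {{ n !≢0 }} orbit-count
  where open Counting n ξ
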